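{- For any weak $(n,m,a,\rho)$-AMD code $(S,G,\mathcal{A},E_u)$, we have $$\rho\ \geq\ \rho_{(n,m,a)}\ \geq\ \min_{K}\left\{\left\lceil\frac{\widetilde{k}a(m-1)}{n-1}\right\rceil\frac{1}{\widetilde{k}m}\,:\,\sum_{1\leq i\leq m}k_i=a\right\},$$ where the minimum is over all tuples $K=(k_1,\dots,k_m)$ of positive integers (the possible values of the sizes of the sets in $\mathcal{A}$) with $\sum_{i}k_i=a$, and $\widetilde{k}=\mathrm{lcm}(k_1,\dots,k_m)$.
   Context: All groups are written additively with identity $0$. Weak AMD code: let $S$ be a set of $m$ source messages, $G$ an Abelian group of order $n$, and $\mathcal{A}=\{A_s : s\in S\}$ a family of pairwise disjoint nonempty subsets of $G$. A source $s\in S$ is chosen uniformly at random, and $E_u$ encodes $s$ as a uniformly random $g\in A_s$. The adversary, with no knowledge of $s$ or $g$, chooses $\Delta\in G\setminus\{0\}$ and wins if $g+\Delta\in A_{s'}$ for some $s'\neq s$. Let $\rho_\Delta$ be the probability of winning with $\Delta$, i.e. $\rho_\Delta=\frac1m\sum_{s\in S}\frac{1}{|A_s|}\,|\{g\in A_s : g+\Delta\in\bigcup_{s'\ne s}A_{s'}\}|$. Then $(S,G,\mathcal{A},E_u)$ is a weak $(n,m,a,\rho)$-AMD code, where $a=\sum_{s\in S}|A_s|$ and $\rho=\max\{\rho_\Delta : \Delta\in G\setminus\{0\}\}$. BSWEDF: for multi-sets $B_1,B_2$ of elements of $G$, $D(B_1,B_2)$ is the multi-set $\{x-y : x\in B_1,\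 y\in B_2\}$; $k\boxtimes B$ is the multi-set in which each element of $B$ is repeated $k$ times; unions are multi-set unions. Let $\mathcal{B}=\{B_i : 1\le i\le m\}$ be a family of pairwise disjoint nonempty subsets of $G$, $k_i=|B_i|$, $K=(k_1,\dots,k_m)$, $a=\sum_i k_i$, $\widetilde{k}=\mathrm{lcm}(k_1,\dots,k_m)$, $\widetilde{B}_i=\frac{\widetilde{k}}{k_i}\boxtimes B_i$. Then $\mathcal{B}$ is an $(n,m,K,a,\lambda)$-BSWEDF (bounded standard weighted external difference family) if $\lambda$ is the smallest positive integer such that $\bigcup_{1\le i\ne j\le m}D(B_i,\widetilde{B}_j)\subseteq\lambda\boxtimes(G\setminus\{0\})$. Define $$\rho_{(n,m,a)}=\min_{K'}\left\{\frac{\lambda'}{\widetilde{k'}m} : \text{there exists an }(n,m,K',a,\lambda')\text{ -BSWEDF (over an Abelian group of order } n)\text{ with }\sum_{i}k'_i=a\right\},$$ where $K'=(k'_1,\dots,k'_m)$ and $\widetilde{k'}=\mathrm{lcm}(k'_1,\dots,k'_m)$.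
   Formalization: The first inequality ρ ≥ ρ_(n,m,a) is stated only for m ≥ 2: for m = 1 one has ρ = 0 while λ must be a positive integer, so ρ_(n,1,a) = 1/a > 0 and the inequality fails. The group order n is at least 2, as needed for the maximum over nonzero Δ. -}

module Defs where

open import Algebra.Bundles using (AbelianGroup)
open import Data.Fin.Base using (Fin)
import Data.Fin.Properties as Fin
open import Data.Fin.Subset
  using (Subset; Nonempty; Empty; _∩_; ⋃; ∣_∣)
open import Data.Fin.Subset.Properties using (_∈?_; x∈p⇒∣p-x∣<∣p∣)
open import Data.Integer.Base using (1ℤ; +_)
open import Data.List.Base
  using (List; allFin; cartesianProduct; cartesianProductWith; concatMap;
         filter; length; map; replicate)
open import Data.Nat.Base as ℕ
  using (ℕ; zero; suc; NonZero; _∸_; >-nonZero; ≢-nonZero; ≢-nonZero⁻¹)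
open import Data.Nat.LCM using (lcm; gcd*lcm)
open import Data.Nat.GCD using (gcd)
import Data.Nat.Properties as ℕ
open import Data.Product.Base using (_×_; _,_; ∃-syntax; uncurry)
open import Data.Rational.Base as ℚ using (ℚ; _/_; ceiling)
import Data.Rational.Properties as ℚ
open import Data.Vec.Functional using (Vector; foldr)
open import Function.Base using (_∘_; flip)
open import Function.Bundles using (Inverse; _↔_)
open import Function.Properties.Inverse using (Inverse⇒Injection)
open import Level using (Level; 0ℓ; _⊔_) renaming (suc to lsuc)
open import Relation.Binary.Core using (Rel)
open import Relation.Binary.Definitions using (Decidable)
open import Relation.Binary.PropositionalEquality
  using (_≡_; _≢_; refl; sym; trans; cong; setoid)
open import Relation.Nullary.Negation using (¬_)
open import Relation.Nullary.Decidable using (¬?; via-injection)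
open import Relation.Unary using (Pred)

open import Algebra.Properties.CommutativeMonoid.Sum ℕ.+-0-commutativeMonoid
  public using (sum)
open import Algebra.Properties.CommutativeMonoid.Sum ℚ.+-0-commutativeMonoid
  public using () renaming (sum to sumℚ)

private variable
  a c ℓ ℓ₁ ℓ₂ s : Level

-- The minimum of a set is attained: it is one of its elements.

IsLeast : {A : Set a} → Rel A ℓ₁ → Pred A ℓ₂ → Pred A (a ⊔ ℓ₁ ⊔ ℓ₂)
IsLeast _≤_ P x = P x × (∀ y → P y → x ≤ y)

IsGreatest : {A : Set a} → Rel A ℓ₁ → Pred A ℓ₂ → Pred A (a ⊔ ℓ₁ ⊔ ℓ₂)
IsGreatest _≤_ = IsLeast (flip _≤_)

record FiniteAbelianGroup (n : ℕ) (c ℓ : Level) : Set (lsuc (c ⊔ ℓ)) where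
  field
    abelianGroup : AbelianGroup c ℓ

  open AbelianGroup abelianGroup public
    using (Carrier; _≈_)
    renaming (setoid to ≈-setoid; _∙_ to _+_; ε to 0#; _⁻¹ to -_)

  field
    enumeration : Inverse ≈-setoid (setoid (Fin n))

  open Inverse enumeration public
    using () renaming (to to index; from to element)

  infixl 6 _-_
  _-_ : Carrier → Carrier → Carrier
  x - y = x + (- y)

  infix 4 _≈?_
  _≈?_ : Decidable _≈_
  _≈?_ = via-injection (Inverse⇒Injection enumeration) Fin._≟_

  -- A subset of the group is a set of indices of its elements.

  elements : Subset n → List Carrier
  elements B = map element (filter (_∈? B) (allFin n))

  nonzeros : List Carrier
  nonzeros = filter (λ g → ¬? (g ≈? 0#)) (map element (allFin n))

  -- Multisets are lists, compared through multiplicities.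

  multiplicity : Carrier → List Carrier → ℕ
  multiplicity g xs = length (filter (g ≈?_) xs)

  infix 4 _⊑_
  _⊑_ : List Carrier → List Carrier → Set c
  xs ⊑ ys = ∀ g → multiplicity g xs ℕ.≤ multiplicity g ys

  D : List Carrier → List Carrier → List Carrier
  D = cartesianProductWith _-_

infixr 7 _⊠_
_⊠_ : {A : Set a} → ℕ → List A → List A
k ⊠ xs = concatMap (replicate k) xs

record IsDisjointFamily {n : ℕ} {I : Set s} (A : I → Subset n) : Set s where
  field
    nonempty : ∀ i → Nonempty (A i)
    disjoint : ∀ {i j} → i ≢ j → Empty (A i ∩ A j)

nonempty⇒∣p∣≢0 : ∀ {n} {p : Subset n} → Nonempty p → NonZero ∣ p ∣
nonempty⇒∣p∣≢0 (_ , x∈p) = >-nonZero (ℕ.≤-<-trans ℕ.z≤n (x∈p⇒∣p-x∣<∣p∣ x∈p))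

record WeakAMDCode (s c ℓ : Level) (n m a : ℕ) .{{_ : NonZero m}} (ρ : ℚ)
                   : Set (lsuc (s ⊔ c ⊔ ℓ)) where
  field
    S        : Set s
    sources  : Fin m ↔ S
    G        : FiniteAbelianGroup n c ℓ
    A        : S → Subset n
    isFamily : IsDisjointFamily A

  open FiniteAbelianGroup G
  open IsDisjointFamily isFamily
  open Inverse sources using () renaming (to to source)

  -- The union of the A s′ over all s′ other than the i-th source.
  others : Fin m → Subset n
  others i = ⋃ (map (A ∘ source) (filter (λ j → ¬? (j Fin.≟ i)) (allFin m)))

  winning : Carrier → Fin m → ℕ
  winning Δ i =
    length (filter (λ g → index (g + Δ) ∈? others i) (elements (A (source i))))

  -- The probability of winning with Δ, when both the source and its encoding
  -- are uniformly distributed.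
  ρ[_] : Carrier → ℚ
  ρ[ Δ ] = (1ℤ / m) ℚ.* sumℚ {m} λ i →
    let instance _ = nonempty⇒∣p∣≢0 (nonempty (source i))
    in (1ℤ / ∣ A (source i) ∣) ℚ.* (+ winning Δ i / 1)

  field
    totalSize : sum {m} (λ i → ∣ A (source i) ∣) ≡ a
    isMaximum : IsGreatest ℚ._≤_ (λ q → ∃[ Δ ] ¬ (Δ ≈ 0#) × q ≡ ρ[ Δ ]) ρ

record Composition (m a : ℕ) : Set where
  field
    part     : Vector ℕ m
    positive : ∀ i → NonZero (part i)
    total    : sum part ≡ a

  instance
    part≢0 : ∀ {i} → NonZero (part i)
    part≢0 {i} = positive i

lcm≢0 : ∀ m n .{{_ : NonZero m}} .{{_ : NonZero n}} → NonZero (lcm m n)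
lcm≢0 m n = ≢-nonZero λ lcm≡0 → ≢-nonZero⁻¹ (m ℕ.* n) {{ℕ.m*n≢0 m n}}
  (trans (sym (gcd*lcm m n))
    (trans (cong (gcd m n ℕ.*_) lcm≡0) (ℕ.*-zeroʳ (gcd m n))))

lcms : ∀ {m} → Vector ℕ m → ℕ
lcms = foldr lcm 1

lcms≢0 : ∀ {m} (k : Vector ℕ m) → (∀ i → NonZero (k i)) → NonZero (lcms k)
lcms≢0 {zero}  k k≢0 = _
lcms≢0 {suc m} k k≢0 = lcm≢0 _ _
  {{k≢0 Fin.zero}} {{lcms≢0 (k ∘ Fin.suc) (k≢0 ∘ Fin.suc)}}

module _ {m a : ℕ} (K : Composition m a) where
  open Composition K

  k̃ : ℕ
  k̃ = lcms part

  k̃*m≢0 : .{{_ : NonZero m}} → NonZero (k̃ ℕ.* m)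
  k̃*m≢0 = ℕ.m*n≢0 k̃ m {{lcms≢0 part positive}}

record BSWEDF (c ℓ : Level) (n m a : ℕ) (K : Composition m a) (λ′ : ℕ)
              : Set (lsuc (c ⊔ ℓ)) where
  open Composition K

  field
    G        : FiniteAbelianGroup n c ℓ
    B        : Fin m → Subset n
    isFamily : IsDisjointFamily B
    sizes    : ∀ i → ∣ B i ∣ ≡ part i

  open FiniteAbelianGroup G

  B̃ : Fin m → List Carrier
  B̃ i = (k̃ K ℕ./ part i) ⊠ elements (B i)

  externalDifferences : List Carrier
  externalDifferences =
    concatMap (λ (i , j) → D (elements (B i)) (B̃ j))
      (filter (¬? ∘ uncurry Fin._≟_) (cartesianProduct (allFin m) (allFin m)))

  field
    isMinimum : IsLeast ℕ._≤_
      (λ l → 1 ℕ.≤ l × externalDifferences ⊑ l ⊠ nonzeros) λ′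

-- Every finite group has an isomorphic copy in the lowest universe, so no
-- generality is lost by taking groups from there.
BSWEDFRatio : (n m a : ℕ) .{{_ : NonZero m}} → Pred ℚ (lsuc 0ℓ)
BSWEDFRatio n m a q = ∃[ K ] ∃[ λ′ ] BSWEDF 0ℓ 0ℓ n m a K λ′ ×
  q ≡ (+ λ′ / (k̃ K ℕ.* m)) {{k̃*m≢0 K}}

BoundRatio : (n m a : ℕ) .{{_ : NonZero m}} .{{_ : NonZero (n ∸ 1)}} → Pred ℚ 0ℓ
BoundRatio n m a q = ∃[ K ]
  q ≡ (ceiling (+ (k̃ K ℕ.* a ℕ.* (m ∸ 1)) / (n ∸ 1)) / (k̃ {m} {a} K ℕ.* m))
        {{k̃*m≢0 K}}

IsMinBSWEDFRatio : (n m a : ℕ) .{{_ : NonZero m}} → Pred ℚ (lsuc 0ℓ)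
IsMinBSWEDFRatio n m a = IsLeast ℚ._≤_ (BSWEDFRatio n m a)

IsMinBoundRatio : (n m a : ℕ) .{{_ : NonZero m}} .{{_ : NonZero (n ∸ 1)}} →
                  Pred ℚ 0ℓ
IsMinBoundRatio n m a = IsLeast ℚ._≤_ (BoundRatio n m a)

{-# OPTIONS --safe #-}

-- The multiplicity of Δ among the external differences is
--   Σⱼ (k̃ / kⱼ) #{ y ∈ Bⱼ : y + Δ lies in another block },
-- which is k̃ m ρ_Δ for the code with the same blocks. So a code is a BSWEDF with
-- ρ = λ / (k̃ m), provided the maximum of these counts is positive (m ≥ 2).
-- Counting all k̃ a (m − 1) external differences, each of the n − 1 nonzero
-- elements occurring at most λ times, gives the lower bound. Both minima exist
-- because there are finitely many compositions of a and, up to isomorphism,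
-- finitely many groups of order n with m disjoint subsets.

module Submission where

open import Defs
open import Algebra.Bundles using (AbelianGroup)
open import Algebra.Bundles.Raw using (RawGroup)
open import Algebra.Consequences.Propositional using (comm∧idˡ⇒id; comm∧invˡ⇒inv)
import Algebra.Morphism.GroupMonomorphism as GroupMonomorphism
open import Algebra.Morphism.Structures using (module GroupMorphisms)
open import Algebra.Structures using (IsAbelianGroup)
open import Data.Bool.Base using (true; false; if_then_else_)
open import Data.Fin.Base using (Fin; zero; suc; toℕ; fromℕ<)
import Data.Fin.Properties as Fin
open import Data.Fin.Subset
  using (Subset; Nonempty; Empty; _∈_; _∩_; ⋃; ∣_∣; inside; outside)
open import Data.Fin.Subset.Properties
  using (_∈?_; nonempty?; ∉⊥; x∈p∪q⁺; x∈p∪q⁻; x∈p∩q⁺)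
open import Data.Integer.Base as ℤ using (1ℤ; +_; +≤+)
import Data.Integer.DivMod as ℤ
import Data.Integer.Properties as ℤ
open import Data.Integer.Solver using () renaming (module +-*-Solver to ℤ-Solver)
open import Data.List.Base
  using (List; []; _∷_; _++_; allFin; cartesianProduct; cartesianProductWith;
         concatMap; filter; length; map; replicate)
import Data.List.Base as List
open import Data.List.Membership.Propositional using (find; lose) renaming (_∈_ to _∈ˡ_)
open import Data.List.Membership.Propositional.Properties
  using (∈-map⁺; ∈-map⁻; ∈-filter⁺; ∈-filter⁻; ∈-allFin; ∈-cartesianProduct⁺;
         ∈-cartesianProductWith⁺)
open import Data.List.Properties using (map-++; map-∘; map-cong; map-tabulate)
import Data.List.Relation.Unary.All as All
open import Data.List.Relation.Unary.Any using (Any; here; there)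
open import Data.Nat.Base as ℕ
  using (ℕ; NonZero; _∸_; zero; suc; _+_; _*_; _⊔_; z≤n; s≤s; ≢-nonZero⁻¹)
  renaming (_≤_ to _≤ⁿ_)
open import Data.Nat.Divisibility using (_∣_; ∣-trans)
open import Data.Nat.DivMod using (m/n*n≡m; /-congˡ; /-congʳ)
open import Data.Nat.LCM using (lcm; m∣lcm[m,n]; n∣lcm[m,n])
open import Data.Nat.ListAction using () renaming (sum to sumᴸ)
open import Data.Nat.ListAction.Properties using (sum-++)
import Data.Nat.Properties as ℕ
open import Data.Nat.Solver using () renaming (module +-*-Solver to ℕ-Solver)
open import Data.Product.Base using (Σ; _×_; _,_; ∃-syntax; uncurry; proj₁; proj₂)
open import Data.Rational.Base as ℚ using (ℚ; _≥_; mkℚ; _/_; toℚᵘ; ceiling)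
import Data.Rational.Properties as ℚ
open import Data.Rational.Unnormalised.Base as ℚᵘ using (mkℚᵘ; *≡*; *≤*)
import Data.Rational.Unnormalised.Properties as ℚᵘ
open import Data.Sum.Base using (inj₁; inj₂; [_,_]′)
open import Data.Vec.Base using (Vec; []; _∷_; lookup; tabulate)
open import Data.Vec.Properties using (lookup∘tabulate)
open import Function.Base using (_∘_; id)
open import Function.Bundles using (_⇔_; mk⇔; Inverse; Injection; Equivalence)
open import Function.Properties.Inverse using (Inverse⇒Injection)
open import Level using (Level; 0ℓ)
open import Relation.Binary.Bundles using (Setoid; DecTotalOrder)
open import Relation.Binary.PropositionalEquality
open import Relation.Nullary using (Dec; yes; no; does; ¬_; contradiction)
open import Relation.Nullary.Decidable using (¬?; _×-dec_; _→-dec_; does-⇔; map′)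
open import Relation.Unary using (Pred; Decidable)

open import Algebra.Properties.CommutativeMonoid.Sum ℚ.+-0-commutativeMonoid
  using () renaming (sum-cong-≗ to sumℚ-cong-≗)
open import Algebra.Properties.Semiring.Sum ℕ.+-*-semiring
  using (*-distribˡ-sum; *-distribʳ-sum; sum-cong-≗; ∑-comm; ∑-distrib-+; sum-replicate-zero)
open import Data.List.Extrema (DecTotalOrder.totalOrder ℚ.≤-decTotalOrder)
  using (argmin; f[argmin]≤f[xs])

-- The minimum over BSWEDFs ranges over groups in the lowest universe, while the group of the code
-- lives at arbitrary levels; moreover, a type of groups cannot be searched. Both obstacles have one
-- remedy: all that matters about a group and its blocks is visible on the indices `Fin n`. The
-- quantities compared are therefore hit counts, functions of an addition table, of subsets and of
-- the weights k̃ / kⱼ, in which the carrier no longer occurs.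
--
-- The passage from differences to hits rewrites x - y = Δ as x = y + Δ. For fixed y there is
-- exactly one such x, and disjointness puts it into at most one block, so the sum over the blocks i
-- ≠ j is the indicator of their union. The weight k̃ / kⱼ is what brings 1 / |Aⱼ| to the common
-- denominator k̃.
--
-- For m = 1 there are no external differences and ρ = 0, whereas λ is positive by definition and
-- equals 1. Hence m ≥ 2 is assumed for the first inequality.

private variable
  p q c ℓ : Level
  m n a : ℕ
  X Y Z : Set c

-- Indicator sums

𝟙 : {P : Set p} → Dec P → ℕ
𝟙 d = if does d then 1 else 0

𝟙-cong : {P : Set p} {Q : Set q} (d : Dec P) (e : Dec Q) → P ⇔ Q → 𝟙 d ≡ 𝟙 e
𝟙-cong d e P⇔Q = cong (if_then 1 else 0) (does-⇔ P⇔Q d e)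

𝟙-no : {P : Set p} (d : Dec P) → ¬ P → 𝟙 d ≡ 0
𝟙-no (yes p) ¬p = contradiction p ¬p
𝟙-no (no _)  _  = refl

𝟙-× : {P : Set p} {Q : Set q} (d : Dec P) (e : Dec Q) → 𝟙 (d ×-dec e) ≡ 𝟙 d * 𝟙 e
𝟙-× (yes _) (yes _) = refl
𝟙-× (yes _) (no _)  = refl
𝟙-× (no _)  _       = refl

sum-δ : ∀ (y : Fin n) (f : Fin n → ℕ) → sum (λ x → 𝟙 (y Fin.≟ x) * f x) ≡ f y
sum-δ {suc n} zero f = begin
  f zero + 0 + sum {n} (λ _ → 0)  ≡⟨ cong₂ _+_ (ℕ.+-identityʳ _) (sum-replicate-zero n) ⟩
  f zero + 0                      ≡⟨ ℕ.+-identityʳ _ ⟩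
  f zero                          ∎
  where open ≡-Reasoning
sum-δ (suc y) f = sum-δ y (f ∘ suc)

-- At most one index contributes, so counting the witnesses amounts to deciding whether one exists.
-- Disjoint unions become sums in this way.
sum-𝟙-unique : {P : Pred (Fin n) p} (P? : Decidable P) →
               (∀ {i j} → P i → P j → i ≡ j) →
               sum (λ i → 𝟙 (P? i)) ≡ 𝟙 (Fin.any? P?)
sum-𝟙-unique {n} {P = P} P? unique with Fin.any? P?
... | yes (i , pi) = begin
  sum (λ j → 𝟙 (P? j))                ≡⟨ sum-cong-≗ {n} (λ j → trans
    (𝟙-cong (P? j) (i Fin.≟ j) (mk⇔ (unique pi) (λ i≡j → subst P i≡j pi)))
    (sym (ℕ.*-identityʳ _))) ⟩
  sum (λ j → 𝟙 (i Fin.≟ j) * 1)       ≡⟨ sum-δ i (λ _ → 1) ⟩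
  1                                    ∎
  where open ≡-Reasoning
... | no ∄ = trans (sum-cong-≗ {n} (λ i → 𝟙-no (P? i) (λ pi → ∄ (i , pi)))) (sum-replicate-zero n)

sum-𝟙-≢ : ∀ (y : Fin n) → sum (λ x → 𝟙 (¬? (y Fin.≟ x))) ≡ n ∸ 1
sum-𝟙-≢ {suc n} zero = sum-1 n
  where
  sum-1 : ∀ n → sum {n} (λ _ → 1) ≡ n
  sum-1 zero    = refl
  sum-1 (suc n) = cong suc (sum-1 n)
sum-𝟙-≢ {suc (suc n)} (suc y) = cong suc (sum-𝟙-≢ y)

sum-mono : ∀ {f g : Fin n → ℕ} → (∀ i → f i ≤ⁿ g i) → sum f ≤ⁿ sum g
sum-mono {zero}  f≤g = z≤n
sum-mono {suc n} f≤g = ℕ.+-mono-≤ (f≤g zero) (sum-mono (f≤g ∘ suc))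

≤-sum : ∀ (f : Fin n → ℕ) i → f i ≤ⁿ sum f
≤-sum f zero    = ℕ.m≤m+n _ _
≤-sum f (suc i) = ℕ.≤-trans (≤-sum (f ∘ suc) i) (ℕ.m≤n+m _ _)

-- Sums over lists

sumOver : (X → ℕ) → List X → ℕ
sumOver f xs = sumᴸ (map f xs)

sumOver-cong : {f g : X → ℕ} → (∀ x → f x ≡ g x) → ∀ xs → sumOver f xs ≡ sumOver g xs
sumOver-cong f≗g xs = cong sumᴸ (map-cong f≗g xs)

sumOver-++ : ∀ (f : X → ℕ) xs ys → sumOver f (xs ++ ys) ≡ sumOver f xs + sumOver f ys
sumOver-++ f xs ys = trans (cong sumᴸ (map-++ f xs ys)) (sum-++ (map f xs) (map f ys))

sumOver-map : ∀ (f : Y → ℕ) (g : X → Y) xs → sumOver f (map g xs) ≡ sumOver (f ∘ g) xs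
sumOver-map f g xs = cong sumᴸ (sym (map-∘ xs))

sumOver-concatMap : ∀ (f : Y → ℕ) (g : X → List Y) xs →
                    sumOver f (concatMap g xs) ≡ sumOver (sumOver f ∘ g) xs
sumOver-concatMap f g []       = refl
sumOver-concatMap f g (x ∷ xs) =
  trans (sumOver-++ f (g x) _) (cong₂ _+_ refl (sumOver-concatMap f g xs))

sumOver-cartesianProductWith : ∀ (f : Z → ℕ) (g : X → Y → Z) xs ys →
  sumOver f (cartesianProductWith g xs ys) ≡ sumOver (λ x → sumOver (f ∘ g x) ys) xs
sumOver-cartesianProductWith f g []       ys = refl
sumOver-cartesianProductWith f g (x ∷ xs) ys = trans
  (sumOver-++ f (map (g x) ys) _)
  (cong₂ _+_ (sumOver-map f (g x) ys) (sumOver-cartesianProductWith f g xs ys))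

sumOver-filter : ∀ {P : Pred X p} (P? : Decidable P) (f : X → ℕ) xs →
                 sumOver f (filter P? xs) ≡ sumOver (λ x → 𝟙 (P? x) * f x) xs
sumOver-filter P? f []       = refl
sumOver-filter P? f (x ∷ xs) with P? x
... | yes _ = cong₂ _+_ (sym (ℕ.+-identityʳ _)) (sumOver-filter P? f xs)
... | no _  = sumOver-filter P? f xs

sumOver-allFin : ∀ (f : Fin n → ℕ) → sumOver f (allFin n) ≡ sum f
sumOver-allFin f = trans (cong sumᴸ (map-tabulate (λ i → i) f)) (sum-tabulate f)
  where
  sum-tabulate : ∀ {n} (f : Fin n → ℕ) → sumᴸ (List.tabulate f) ≡ sum f
  sum-tabulate {zero}  f = refl
  sum-tabulate {suc n} f = cong₂ _+_ refl (sum-tabulate (f ∘ suc))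

sumOver-⊠ : ∀ (f : X → ℕ) k xs → sumOver f (k ⊠ xs) ≡ k * sumOver f xs
sumOver-⊠ f k []       = sym (ℕ.*-zeroʳ k)
sumOver-⊠ f k (x ∷ xs) = begin
  sumOver f (replicate k x ++ k ⊠ xs)             ≡⟨ sumOver-++ f (replicate k x) _ ⟩
  sumOver f (replicate k x) + sumOver f (k ⊠ xs)  ≡⟨ cong₂ _+_ (sumOver-replicate k) (sumOver-⊠ f k xs) ⟩
  k * f x + k * sumOver f xs                      ≡⟨ ℕ.*-distribˡ-+ k (f x) _ ⟨
  k * (f x + sumOver f xs)                        ∎
  where
  open ≡-Reasoning
  sumOver-replicate : ∀ k → sumOver f (replicate k x) ≡ k * f x
  sumOver-replicate zero    = refl
  sumOver-replicate (suc k) = cong₂ _+_ refl (sumOver-replicate k)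

length≡sumOver : ∀ (xs : List X) → length xs ≡ sumOver (λ _ → 1) xs
length≡sumOver []       = refl
length≡sumOver (x ∷ xs) = cong suc (length≡sumOver xs)

length-filter≡sumOver : ∀ {P : Pred X p} (P? : Decidable P) xs →
                        length (filter P? xs) ≡ sumOver (λ x → 𝟙 (P? x)) xs
length-filter≡sumOver P? xs = begin
  length (filter P? xs)               ≡⟨ length≡sumOver (filter P? xs) ⟩
  sumOver (λ _ → 1) (filter P? xs)    ≡⟨ sumOver-filter P? _ xs ⟩
  sumOver (λ x → 𝟙 (P? x) * 1) xs     ≡⟨ sumOver-cong (λ x → ℕ.*-identityʳ _) xs ⟩
  sumOver (λ x → 𝟙 (P? x)) xs         ∎
  where open ≡-Reasoning

∣p∣≡sum : ∀ (p : Subset n) → ∣ p ∣ ≡ sum (λ x → 𝟙 (x ∈? p))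
∣p∣≡sum []            = refl
∣p∣≡sum (inside  ∷ p) = cong suc (∣p∣≡sum p)
∣p∣≡sum (outside ∷ p) = ∣p∣≡sum p

x∈⋃⁺ : ∀ {x : Fin n} {ps} → Any (x ∈_) ps → x ∈ ⋃ ps
x∈⋃⁺ (here x∈p)   = x∈p∪q⁺ (inj₁ x∈p)
x∈⋃⁺ (there x∈ps) = x∈p∪q⁺ (inj₂ (x∈⋃⁺ x∈ps))

x∈⋃⁻ : ∀ {x : Fin n} ps → x ∈ ⋃ ps → Any (x ∈_) ps
x∈⋃⁻ []       x∈⊥ = contradiction x∈⊥ ∉⊥
x∈⋃⁻ (p ∷ ps) x∈∪ = [ here , there ∘ x∈⋃⁻ ps ]′ (x∈p∪q⁻ p (⋃ ps) x∈∪)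

-- Multiplicities of external differences

-- Written so that for the blocks `A ∘ source` it agrees definitionally with the `others` of a
-- `WeakAMDCode`.
others : (Fin m → Subset n) → Fin m → Subset n
others {m} B j = ⋃ (map B (filter (λ i → ¬? (i Fin.≟ j)) (allFin m)))

∈others⇔ : ∀ (B : Fin m → Subset n) j {x} → x ∈ others B j ⇔ (∃[ i ] i ≢ j × x ∈ B i)
∈others⇔ {m} B j {x} = mk⇔
  (λ x∈o → let p , p∈ , x∈p = find (x∈⋃⁻ _ x∈o)
               i , i∈ , p≡ = ∈-map⁻ B p∈
           in i , proj₂ (∈-filter⁻ (λ i → ¬? (i Fin.≟ j)) {xs = allFin m} i∈) , subst (x ∈_) p≡ x∈p)
  (λ (i , i≢j , x∈B) → x∈⋃⁺ (lose
     (∈-map⁺ B (∈-filter⁺ (λ i → ¬? (i Fin.≟ j)) (∈-allFin i) i≢j)) x∈B))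

-- The addition is an arbitrary function on indices, not that of a given group, so that a group and
-- its table can be compared pointwise by `hits-cong`.
hits : (Fin n → Fin n → Fin n) → (Fin m → Subset n) → Fin m → Fin n → ℕ
hits op B j δ = sum (λ y → 𝟙 (y ∈? B j) * 𝟙 (op y δ ∈? others B j))

weightedHits : (Fin m → ℕ) → (Fin n → Fin n → Fin n) → (Fin m → Subset n) → Fin n → ℕ
weightedHits c op B δ = sum (λ j → c j * hits op B j δ)

others-cong : ∀ {B B′ : Fin m → Subset n} → B ≗ B′ → others B ≗ others B′
others-cong {m} B≗B′ j = cong ⋃ (map-cong B≗B′ (filter (λ i → ¬? (i Fin.≟ j)) (allFin m)))

hits-cong : ∀ {op op′ : Fin n → Fin n → Fin n} {B B′ : Fin m → Subset n} →
            (∀ x y → op x y ≡ op′ x y) → B ≗ B′ → ∀ j δ → hits op B j δ ≡ hits op′ B′ j δ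
hits-cong {n} op≗ B≗ j δ = sum-cong-≗ {n} (λ y → cong₂ _*_
  (cong (λ p → 𝟙 (y ∈? p)) (B≗ j))
  (cong₂ (λ z p → 𝟙 (z ∈? p)) (op≗ y δ) (others-cong B≗ j)))

weightedHits-cong : ∀ {c c′ : Fin m → ℕ} {op op′ : Fin n → Fin n → Fin n} {B B′ : Fin m → Subset n} →
  c ≗ c′ → (∀ x y → op x y ≡ op′ x y) → B ≗ B′ →
  ∀ δ → weightedHits c op B δ ≡ weightedHits c′ op′ B′ δ
weightedHits-cong {m} c≗ op≗ B≗ δ =
  sum-cong-≗ {m} (λ j → cong₂ _*_ (c≗ j) (hits-cong op≗ B≗ j δ))

module _ {B : Fin m → Subset n} (isFamily : IsDisjointFamily B) where
  open IsDisjointFamily isFamily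

  block-unique : ∀ {x i j} → x ∈ B i → x ∈ B j → i ≡ j
  block-unique {x} {i} {j} x∈Bi x∈Bj with i Fin.≟ j
  ... | yes i≡j = i≡j
  ... | no i≢j  = contradiction (x , x∈p∩q⁺ (x∈Bi , x∈Bj)) (disjoint i≢j)

  -- Only one block can contain `x`, so the sum has at most one nonzero term.
  𝟙-others : ∀ j x → 𝟙 (x ∈? others B j) ≡ sum (λ i → 𝟙 (¬? (i Fin.≟ j)) * 𝟙 (x ∈? B i))
  𝟙-others j x = begin
    𝟙 (x ∈? others B j)                               ≡⟨ 𝟙-cong (x ∈? others B j) (Fin.any? R?) (∈others⇔ B j) ⟩
    𝟙 (Fin.any? R?)                                   ≡⟨ sum-𝟙-unique R? (λ (_ , x∈Bi) (_ , x∈Bj) → block-unique x∈Bi x∈Bj) ⟨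
    sum (λ i → 𝟙 (R? i))                              ≡⟨ sum-cong-≗ {m} (λ i → 𝟙-× (¬? (i Fin.≟ j)) (x ∈? B i)) ⟩
    sum (λ i → 𝟙 (¬? (i Fin.≟ j)) * 𝟙 (x ∈? B i))     ∎
    where
    open ≡-Reasoning
    R? = λ i → ¬? (i Fin.≟ j) ×-dec (x ∈? B i)

-- Serves two exchanges: `x` as an element of the first block, to be eliminated for a fixed `y`, and
-- `x` as the index of that block, to be absorbed into a union.
sum-swap : ∀ (k : ℕ) (e : Fin m → ℕ) (a : Fin n → ℕ) (b : Fin m → Fin n → ℕ) →
           sum (λ x → e x * (k * sum (λ y → a y * b x y))) ≡
           k * sum (λ y → a y * sum (λ x → e x * b x y))
sum-swap {m} {n} k e a b = begin
  sum (λ x → e x * (k * sum (λ y → a y * b x y)))     ≡⟨ sum-cong-≗ {m} (λ x → trans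
    (sym (ℕ.*-assoc (e x) k _)) (*-distribˡ-sum (e x * k) (λ y → a y * b x y))) ⟩
  sum (λ x → sum (λ y → e x * k * (a y * b x y)))     ≡⟨ ∑-comm (λ x y → e x * k * (a y * b x y)) ⟩
  sum (λ y → sum (λ x → e x * k * (a y * b x y)))     ≡⟨ sum-cong-≗ {n} (λ y → sum-cong-≗ {m} (λ x → solve 4
    (λ e k a b → e :* k :* (a :* b) := k :* a :* (e :* b)) refl (e x) k (a y) (b x y))) ⟩
  sum (λ y → sum (λ x → k * a y * (e x * b x y)))     ≡⟨ sum-cong-≗ {n} (λ y → trans
    (sym (*-distribˡ-sum (k * a y) (λ x → e x * b x y))) (ℕ.*-assoc k (a y) _)) ⟩
  sum (λ y → k * (a y * sum (λ x → e x * b x y)))     ≡⟨ *-distribˡ-sum k (λ y → a y * sum (λ x → e x * b x y)) ⟨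
  k * sum (λ y → a y * sum (λ x → e x * b x y))       ∎
  where
  open ≡-Reasoning
  open ℕ-Solver

module _ (G : FiniteAbelianGroup n c ℓ) where
  open FiniteAbelianGroup G hiding (_+_)
  open FiniteAbelianGroup G using () renaming (_+_ to _⊕_)
  open AbelianGroup abelianGroup using (∙-cong; identityʳ; group)
  private module ≈ = Setoid ≈-setoid
  open Inverse enumeration using (strictlyInverseˡ; strictlyInverseʳ)
    renaming (to-cong to index-cong; from-cong to element-cong)

  op : Fin n → Fin n → Fin n
  op x y = index (element x ⊕ element y)

  -- The external differences of a BSWEDF, for any weights c j in place of k̃ / k j.
  differences : (Fin m → ℕ) → (Fin m → Subset n) → List Carrier
  differences {m} c B =
    concatMap (λ (i , j) → D (elements (B i)) (c j ⊠ elements (B j)))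
      (filter (¬? ∘ uncurry Fin._≟_) (cartesianProduct (allFin m) (allFin m)))

  sumOver-elements : ∀ (f : Carrier → ℕ) (p : Subset n) →
                     sumOver f (elements p) ≡ sum (λ x → 𝟙 (x ∈? p) * f (element x))
  sumOver-elements f p = begin
    sumOver f (elements p)                                      ≡⟨ sumOver-map f element (filter (_∈? p) (allFin n)) ⟩
    sumOver (f ∘ element) (filter (_∈? p) (allFin n))           ≡⟨ sumOver-filter (_∈? p) (f ∘ element) (allFin n) ⟩
    sumOver (λ x → 𝟙 (x ∈? p) * f (element x)) (allFin n)       ≡⟨ sumOver-allFin (λ x → 𝟙 (x ∈? p) * f (element x)) ⟩
    sum (λ x → 𝟙 (x ∈? p) * f (element x))                      ∎
    where open ≡-Reasoning

  sumOver-differences : ∀ (f : Carrier → ℕ) (c : Fin m → ℕ) (B : Fin m → Subset n) →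
    sumOver f (differences c B) ≡
    sum (λ i → sum (λ j → 𝟙 (¬? (i Fin.≟ j)) *
      sum (λ x → 𝟙 (x ∈? B i) *
        (c j * sum (λ y → 𝟙 (y ∈? B j) * f (element x - element y))))))
  sumOver-differences {m} f c B = begin
    sumOver f (differences c B)                                      ≡⟨ sumOver-concatMap f _ (filter (¬? ∘ uncurry Fin._≟_) pairs) ⟩
    sumOver (sumOver f ∘ Ds) (filter (¬? ∘ uncurry Fin._≟_) pairs)    ≡⟨ sumOver-filter (¬? ∘ uncurry Fin._≟_) _ pairs ⟩
    sumOver (λ ij → 𝟙 (¬? (uncurry Fin._≟_ ij)) * sumOver f (Ds ij)) pairs
                                                                     ≡⟨ sumOver-cartesianProductWith (λ ij → 𝟙 (¬? (uncurry Fin._≟_ ij)) * sumOver f (Ds ij)) _,_ (allFin m) (allFin m) ⟩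
    sumOver (λ i → sumOver (λ j → 𝟙 (¬? (i Fin.≟ j)) * sumOver f (Ds (i , j))) (allFin m)) (allFin m)
      ≡⟨ sumOver-allFin {m} _ ⟩
    sum (λ i → sumOver (λ j → 𝟙 (¬? (i Fin.≟ j)) * sumOver f (Ds (i , j))) (allFin m))
      ≡⟨ sum-cong-≗ {m} (λ i → trans (sumOver-allFin {m} _) (sum-cong-≗ {m} (λ j →
           cong (𝟙 (¬? (i Fin.≟ j)) *_) (block i j)))) ⟩
    _ ∎
    where
    open ≡-Reasoning
    pairs = cartesianProduct (allFin m) (allFin m)
    Ds : Fin m × Fin m → List Carrier
    Ds (i , j) = D (elements (B i)) (c j ⊠ elements (B j))
    block : ∀ i j → sumOver f (Ds (i , j)) ≡
            sum (λ x → 𝟙 (x ∈? B i) * (c j * sum (λ y → 𝟙 (y ∈? B j) * f (element x - element y))))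
    block i j = begin
      sumOver f (Ds (i , j))
        ≡⟨ sumOver-cartesianProductWith f _-_ (elements (B i)) (c j ⊠ elements (B j)) ⟩
      sumOver (λ g → sumOver (λ h → f (g - h)) (c j ⊠ elements (B j))) (elements (B i))
        ≡⟨ sumOver-elements (λ g → sumOver (λ h → f (g - h)) (c j ⊠ elements (B j))) (B i) ⟩
      sum (λ x → 𝟙 (x ∈? B i) * sumOver (λ h → f (element x - h)) (c j ⊠ elements (B j)))
        ≡⟨ sum-cong-≗ {n} (λ x → cong (𝟙 (x ∈? B i) *_) (trans
             (sumOver-⊠ (λ h → f (element x - h)) (c j) (elements (B j)))
             (cong (c j *_) (sumOver-elements (λ h → f (element x - h)) (B j))))) ⟩
      _ ∎

  ≈⇔index : ∀ {g x} → g ≈ element x ⇔ index g ≡ x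
  ≈⇔index {g} {x} = mk⇔
    (λ g≈x → trans (index-cong g≈x) (strictlyInverseˡ x))
    (λ i≡x → ≈.trans (≈.sym (strictlyInverseʳ g)) (element-cong i≡x))

  op-index : ∀ y g → op y (index g) ≡ index (element y ⊕ g)
  op-index y g = index-cong (∙-cong ≈.refl (strictlyInverseʳ g))

  op-0# : ∀ y → op y (index 0#) ≡ y
  op-0# y = trans (op-index y 0#) (trans (index-cong (identityʳ _)) (strictlyInverseˡ y))

  -- Adding `element y` on both sides solves the difference for `x`. In the form
  -- `op y (index g) ≡ x` the condition is a Kronecker delta in `x`, ready for `sum-δ`.
  ≈-⇔op : ∀ g x y → g ≈ (element x - element y) ⇔ op y (index g) ≡ x
  ≈-⇔op g x y = mk⇔
    (λ g≈ → trans (op-index y g) (Equivalence.to ≈⇔index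
      (≈.trans (∙-cong ≈.refl g≈) (≈.trans (comm _ _) (//-rightDividesˡ _ _)))))
    (λ op≡ → ≈.trans (≈.sym (//-rightDividesʳ (element y) g))
      (∙-cong (≈.trans (comm _ _) (Equivalence.from ≈⇔index (trans (sym (op-index y g)) op≡))) ≈.refl))
    where
    open AbelianGroup abelianGroup using (comm)
    open import Algebra.Properties.Group group using (//-rightDividesˡ; //-rightDividesʳ)

  multiplicity≡sumOver : ∀ g xs → multiplicity g xs ≡ sumOver (λ x → 𝟙 (g ≈? x)) xs
  multiplicity≡sumOver g xs = length-filter≡sumOver (g ≈?_) xs

  multiplicity-differences :
    ∀ (c : Fin m → ℕ) {B : Fin m → Subset n} → IsDisjointFamily B → ∀ g →
    multiplicity g (differences c B) ≡ weightedHits c op B (index g)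
  multiplicity-differences {m} c {B} isFamily g = begin
    multiplicity g (differences c B)
      ≡⟨ multiplicity≡sumOver g (differences c B) ⟩
    sumOver (λ x → 𝟙 (g ≈? x)) (differences c B)
      ≡⟨ sumOver-differences (λ x → 𝟙 (g ≈? x)) c B ⟩
    sum (λ i → sum (λ j → 𝟙 (¬? (i Fin.≟ j)) * F i j))
      -- The block `j` of the subtrahend carries the weight and plays the encoded source, so it
      -- becomes the outer index.
      ≡⟨ ∑-comm (λ i j → 𝟙 (¬? (i Fin.≟ j)) * F i j) ⟩
    sum (λ j → sum (λ i → 𝟙 (¬? (i Fin.≟ j)) * F i j))
      ≡⟨ sum-cong-≗ {m} (λ j → begin
           sum (λ i → 𝟙 (¬? (i Fin.≟ j)) * F i j)
             ≡⟨ sum-cong-≗ {m} (λ i → cong (𝟙 (¬? (i Fin.≟ j)) *_) (F≡ i j)) ⟩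
           sum (λ i → 𝟙 (¬? (i Fin.≟ j)) *
             (c j * sum (λ y → 𝟙 (y ∈? B j) * 𝟙 (op y δ ∈? B i))))
             ≡⟨ sum-swap (c j) (λ i → 𝟙 (¬? (i Fin.≟ j))) (λ y → 𝟙 (y ∈? B j)) (λ i y → 𝟙 (op y δ ∈? B i)) ⟩
           c j * sum (λ y → 𝟙 (y ∈? B j) * sum (λ i → 𝟙 (¬? (i Fin.≟ j)) * 𝟙 (op y δ ∈? B i)))
             ≡⟨ cong (c j *_) (sum-cong-≗ {n} (λ y → cong (𝟙 (y ∈? B j) *_)
                  (𝟙-others isFamily j (op y δ)))) ⟨
           c j * hits op B j δ ∎) ⟩
    weightedHits c op B δ ∎
    where
    open ≡-Reasoning
    δ = index g
    F : Fin m → Fin m → ℕ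
    F i j = sum (λ x → 𝟙 (x ∈? B i) *
      (c j * sum (λ y → 𝟙 (y ∈? B j) * 𝟙 (g ≈? (element x - element y)))))
    F≡ : ∀ i j → F i j ≡ c j * sum (λ y → 𝟙 (y ∈? B j) * 𝟙 (op y δ ∈? B i))
    F≡ i j = begin
      F i j
        ≡⟨ sum-swap (c j) (λ x → 𝟙 (x ∈? B i)) (λ y → 𝟙 (y ∈? B j)) (λ x y → 𝟙 (g ≈? (element x - element y))) ⟩
      c j * sum (λ y → 𝟙 (y ∈? B j) * sum (λ x → 𝟙 (x ∈? B i) * 𝟙 (g ≈? (element x - element y))))
        -- For a fixed `y` only `x` = `op y δ` survives, leaving the test whether it lies in `B i`.
        ≡⟨ cong (c j *_) (sum-cong-≗ {n} (λ y → cong (𝟙 (y ∈? B j) *_) (trans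
             (sum-cong-≗ {n} (λ x → trans (ℕ.*-comm (𝟙 (x ∈? B i)) _) (cong (_* 𝟙 (x ∈? B i))
               (𝟙-cong (g ≈? (element x - element y)) (op y δ Fin.≟ x) (≈-⇔op g x y)))))
             (sum-δ (op y δ) (λ x → 𝟙 (x ∈? B i)))))) ⟩
      c j * sum (λ y → 𝟙 (y ∈? B j) * 𝟙 (op y δ ∈? B i)) ∎

  -- Translation by zero leaves `y` in its own block, which is disjoint from all others.
  weightedHits-0# : ∀ (c : Fin m → ℕ) {B : Fin m → Subset n} → IsDisjointFamily B →
                    weightedHits c op B (index 0#) ≡ 0
  weightedHits-0# {m} c {B} isFamily = sum-zero (λ j →
    trans (cong (c j *_) (sum-zero (λ y → no-hit j y))) (ℕ.*-zeroʳ (c j)))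
    where
    sum-zero : ∀ {k} {f : Fin k → ℕ} → (∀ i → f i ≡ 0) → sum f ≡ 0
    sum-zero {k} f≗0 = trans (sum-cong-≗ {k} f≗0) (sum-replicate-zero k)
    no-hit : ∀ j y → 𝟙 (y ∈? B j) * 𝟙 (op y (index 0#) ∈? others B j) ≡ 0
    no-hit j y rewrite op-0# y with y ∈? B j
    ... | no _ = refl
    ... | yes y∈Bj = trans (ℕ.+-identityʳ _) (𝟙-no (y ∈? others B j) λ y∈o →
      let i , i≢j , y∈Bi = Equivalence.to (∈others⇔ B j) y∈o
      in i≢j (block-unique isFamily y∈Bi y∈Bj))

  sumOver-nonzeros : ∀ (f : Carrier → ℕ) →
    sumOver f nonzeros ≡ sum (λ x → 𝟙 (¬? (element x ≈? 0#)) * f (element x))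
  sumOver-nonzeros f = begin
    sumOver f nonzeros
      ≡⟨ sumOver-filter (λ g → ¬? (g ≈? 0#)) f (map element (allFin n)) ⟩
    sumOver (λ g → 𝟙 (¬? (g ≈? 0#)) * f g) (map element (allFin n))
      ≡⟨ sumOver-map (λ g → 𝟙 (¬? (g ≈? 0#)) * f g) element (allFin n) ⟩
    sumOver (λ x → 𝟙 (¬? (element x ≈? 0#)) * f (element x)) (allFin n)
      ≡⟨ sumOver-allFin (λ x → 𝟙 (¬? (element x ≈? 0#)) * f (element x)) ⟩
    sum (λ x → 𝟙 (¬? (element x ≈? 0#)) * f (element x)) ∎
    where open ≡-Reasoning

  multiplicity-⊠-nonzeros : ∀ l g → multiplicity g (l ⊠ nonzeros) ≡ l * 𝟙 (¬? (g ≈? 0#))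
  multiplicity-⊠-nonzeros l g = begin
    multiplicity g (l ⊠ nonzeros)
      ≡⟨ multiplicity≡sumOver g (l ⊠ nonzeros) ⟩
    sumOver (λ x → 𝟙 (g ≈? x)) (l ⊠ nonzeros)
      ≡⟨ sumOver-⊠ (λ x → 𝟙 (g ≈? x)) l nonzeros ⟩
    l * sumOver (λ x → 𝟙 (g ≈? x)) nonzeros
      ≡⟨ cong (l *_) (begin
           sumOver (λ x → 𝟙 (g ≈? x)) nonzeros
             ≡⟨ sumOver-nonzeros (λ x → 𝟙 (g ≈? x)) ⟩
           sum (λ x → 𝟙 (¬? (element x ≈? 0#)) * 𝟙 (g ≈? element x))
             ≡⟨ sum-cong-≗ {n} (λ x → trans (ℕ.*-comm (𝟙 (¬? (element x ≈? 0#))) _)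
                  (cong (_* 𝟙 (¬? (element x ≈? 0#))) (𝟙-cong (g ≈? element x) (index g Fin.≟ x) ≈⇔index))) ⟩
           sum (λ x → 𝟙 (index g Fin.≟ x) * 𝟙 (¬? (element x ≈? 0#)))
             ≡⟨ sum-δ (index g) (λ x → 𝟙 (¬? (element x ≈? 0#))) ⟩
           𝟙 (¬? (element (index g) ≈? 0#))
             ≡⟨ 𝟙-cong (¬? (element (index g) ≈? 0#)) (¬? (g ≈? 0#)) (mk⇔
                  (λ eg≉0 g≈0 → eg≉0 (≈.trans (strictlyInverseʳ g) g≈0))
                  (λ g≉0 eg≈0 → g≉0 (≈.trans (≈.sym (strictlyInverseʳ g)) eg≈0))) ⟩
           𝟙 (¬? (g ≈? 0#)) ∎) ⟩
    l * 𝟙 (¬? (g ≈? 0#)) ∎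
    where open ≡-Reasoning

  -- At zero the right-hand multiset has multiplicity 0, and so does the left by `weightedHits-0#`.
  -- The bound can therefore range over all indices, and zero need not be singled out in the finite
  -- data.
  ⊑⊠⇔ : ∀ (c : Fin m → ℕ) {B : Fin m → Subset n} → IsDisjointFamily B → ∀ l →
         differences c B ⊑ l ⊠ nonzeros ⇔ (∀ δ → weightedHits c op B δ ≤ⁿ l)
  ⊑⊠⇔ c {B} isFamily l = mk⇔ bounded dominated
    where
    bounded : differences c B ⊑ l ⊠ nonzeros → ∀ δ → weightedHits c op B δ ≤ⁿ l
    bounded ⊑l δ = begin
      weightedHits c op B δ
        ≡⟨ cong (weightedHits c op B) (strictlyInverseˡ δ) ⟨
      weightedHits c op B (index (element δ))
        ≡⟨ multiplicity-differences c isFamily (element δ) ⟨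
      multiplicity (element δ) (differences c B)
        ≤⟨ ⊑l (element δ) ⟩
      multiplicity (element δ) (l ⊠ nonzeros)
        ≡⟨ multiplicity-⊠-nonzeros l (element δ) ⟩
      l * 𝟙 (¬? (element δ ≈? 0#))
        ≤⟨ ℕ.*-monoʳ-≤ l (𝟙≤1 (¬? (element δ ≈? 0#))) ⟩
      l * 1
        ≡⟨ ℕ.*-identityʳ l ⟩
      l ∎
      where
      open ℕ.≤-Reasoning
      𝟙≤1 : ∀ {P : Set p} (d : Dec P) → 𝟙 d ≤ⁿ 1
      𝟙≤1 (yes _) = ℕ.≤-refl
      𝟙≤1 (no _)  = z≤n
    dominated : (∀ δ → weightedHits c op B δ ≤ⁿ l) → differences c B ⊑ l ⊠ nonzeros
    dominated ≤l g = subst₂ _≤ⁿ_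
      (sym (multiplicity-differences c isFamily g)) (sym (multiplicity-⊠-nonzeros l g)) (cases (g ≈? 0#))
      where
      cases : (d : Dec (g ≈ 0#)) → weightedHits c op B (index g) ≤ⁿ l * 𝟙 (¬? d)
      cases (yes g≈0) = ℕ.≤-trans (ℕ.≤-reflexive
        (trans (cong (weightedHits c op B) (index-cong g≈0)) (weightedHits-0# c isFamily))) z≤n
      cases (no _)    = subst (weightedHits c op B (index g) ≤ⁿ_) (sym (ℕ.*-identityʳ l)) (≤l (index g))

  -- Since `element` and `index` are inverse up to `_≈_`, each list entry is counted at exactly one
  -- index.
  sum-multiplicity : ∀ xs → sum (λ δ → multiplicity (element δ) xs) ≡ length xs
  sum-multiplicity xs = trans
    (sum-cong-≗ {n} (λ δ → multiplicity≡sumOver (element δ) xs)) (count xs)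
    where
    open ≡-Reasoning
    count : ∀ xs → sum (λ δ → sumOver (λ x → 𝟙 (element δ ≈? x)) xs) ≡ length xs
    count []       = sum-replicate-zero n
    count (x ∷ xs) = begin
      sum (λ δ → 𝟙 (element δ ≈? x) + sumOver (λ x → 𝟙 (element δ ≈? x)) xs)
        ≡⟨ ∑-distrib-+ (λ δ → 𝟙 (element δ ≈? x)) (λ δ → sumOver (λ x → 𝟙 (element δ ≈? x)) xs) ⟩
      sum (λ δ → 𝟙 (element δ ≈? x)) + sum (λ δ → sumOver (λ x → 𝟙 (element δ ≈? x)) xs)
        ≡⟨ cong₂ _+_ (trans (sum-cong-≗ {n} (λ δ → trans
             (𝟙-cong (element δ ≈? x) (index x Fin.≟ δ) (mk⇔
               (λ δ≈x → Equivalence.to ≈⇔index (≈.sym δ≈x))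
               (λ x≡δ → ≈.sym (Equivalence.from ≈⇔index x≡δ))))
             (sym (ℕ.*-identityʳ _)))) (sum-δ (index x) (λ _ → 1))) (count xs) ⟩
      suc (length xs) ∎

  length-elements : ∀ (p : Subset n) → sum (λ x → 𝟙 (x ∈? p) * 1) ≡ ∣ p ∣
  length-elements p = trans (sum-cong-≗ {n} (λ x → ℕ.*-identityʳ _)) (sym (∣p∣≡sum p))

  length-nonzeros : length nonzeros ≡ n ∸ 1
  length-nonzeros = begin
    length nonzeros                                 ≡⟨ length≡sumOver nonzeros ⟩
    sumOver (λ _ → 1) nonzeros                      ≡⟨ sumOver-nonzeros (λ _ → 1) ⟩
    sum (λ x → 𝟙 (¬? (element x ≈? 0#)) * 1)        ≡⟨ sum-cong-≗ {n} (λ x → trans (ℕ.*-identityʳ _)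
      (𝟙-cong (¬? (element x ≈? 0#)) (¬? (index 0# Fin.≟ x)) (mk⇔
        (λ x≉0 0≡x → x≉0 (≈.sym (Equivalence.from ≈⇔index 0≡x)))
        (λ 0≢x x≈0 → 0≢x (Equivalence.to ≈⇔index (≈.sym x≈0)))))) ⟩
    sum (λ x → 𝟙 (¬? (index 0# Fin.≟ x)))           ≡⟨ sum-𝟙-≢ (index 0#) ⟩
    n ∸ 1                                           ∎
    where open ≡-Reasoning

  -- The hypothesis gives all the repeated blocks `c j ⊠ elements (B j)` the same length `k`, so
  -- every element of `B i` is paired with `k` entries for each of the `m ∸ 1` other blocks,
  -- whatever their sizes.
  length-differences : ∀ {k : ℕ} (c : Fin m → ℕ) (B : Fin m → Subset n) → (∀ j → c j * ∣ B j ∣ ≡ k) →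
                       length (differences c B) ≡ k * sum (λ i → ∣ B i ∣) * (m ∸ 1)
  length-differences {m} {k} c B c*∣B∣≡k = begin
    length (differences c B)                   ≡⟨ length≡sumOver (differences c B) ⟩
    sumOver (λ _ → 1) (differences c B)        ≡⟨ sumOver-differences (λ _ → 1) c B ⟩
    sum (λ i → sum (λ j → 𝟙 (¬? (i Fin.≟ j)) * sum (λ x → 𝟙 (x ∈? B i) * (c j * sum (λ y → 𝟙 (y ∈? B j) * 1)))))
      ≡⟨ sum-cong-≗ {m} (λ i → trans
           (sum-cong-≗ {m} (λ j → cong (𝟙 (¬? (i Fin.≟ j)) *_) (trans
             (sum-cong-≗ {n} (λ x → cong (𝟙 (x ∈? B i) *_)
               (trans (cong (c j *_) (length-elements (B j))) (c*∣B∣≡k j))))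
             (trans (sym (*-distribʳ-sum k (λ x → 𝟙 (x ∈? B i)))) (cong (_* k) (sym (∣p∣≡sum (B i))))))))
           (trans (sym (*-distribʳ-sum (∣ B i ∣ * k) (λ j → 𝟙 (¬? (i Fin.≟ j)))))
             (trans (cong (_* (∣ B i ∣ * k)) (sum-𝟙-≢ i))
               (solve 3 (λ m b k → m :* (b :* k) := k :* m :* b) refl (m ∸ 1) ∣ B i ∣ k)))) ⟩
    sum (λ i → k * (m ∸ 1) * ∣ B i ∣)          ≡⟨ *-distribˡ-sum (k * (m ∸ 1)) (λ i → ∣ B i ∣) ⟨
    k * (m ∸ 1) * sum (λ i → ∣ B i ∣)          ≡⟨ solve 3 (λ k m s → k :* m :* s := k :* s :* m) refl k (m ∸ 1) (sum (λ i → ∣ B i ∣)) ⟩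
    k * sum (λ i → ∣ B i ∣) * (m ∸ 1)          ∎
    where
    open ≡-Reasoning
    open ℕ-Solver

  -- Double counting. Besides the lower bound for λ it yields the positivity of the maximal hit
  -- count of a code, because `l` = 0 would force the left side to vanish.
  counting-bound : ∀ {k l : ℕ} (c : Fin m → ℕ) (B : Fin m → Subset n) → (∀ j → c j * ∣ B j ∣ ≡ k) →
                   differences c B ⊑ l ⊠ nonzeros →
                   k * sum (λ i → ∣ B i ∣) * (m ∸ 1) ≤ⁿ l * (n ∸ 1)
  counting-bound {m} {k} {l} c B c*∣B∣≡k ⊑l = begin
    k * sum (λ i → ∣ B i ∣) * (m ∸ 1)                          ≡⟨ length-differences c B c*∣B∣≡k ⟨
    length (differences c B)                                   ≡⟨ sum-multiplicity (differences c B) ⟨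
    sum (λ δ → multiplicity (element δ) (differences c B))     ≤⟨ sum-mono (λ δ → ⊑l (element δ)) ⟩
    sum (λ δ → multiplicity (element δ) (l ⊠ nonzeros))        ≡⟨ sum-multiplicity (l ⊠ nonzeros) ⟩
    length (l ⊠ nonzeros)                                      ≡⟨ length≡sumOver (l ⊠ nonzeros) ⟩
    sumOver (λ _ → 1) (l ⊠ nonzeros)                           ≡⟨ sumOver-⊠ (λ _ → 1) l nonzeros ⟩
    l * sumOver (λ _ → 1) nonzeros                             ≡⟨ cong (l *_) (length≡sumOver nonzeros) ⟨
    l * length nonzeros                                        ≡⟨ cong (l *_) length-nonzeros ⟩
    l * (n ∸ 1)                                                ∎
    where open ℕ.≤-Reasoning

-- Quotients in ℚ

-- Division in `ℚ` cancels common factors, which obstructs computation with variables. Unnormalised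
-- fractions keep numerator and denominator, so the identities below are checked there.
toℚᵘ-/ : ∀ i d → toℚᵘ (i / suc d) ℚᵘ.≃ mkℚᵘ i d
toℚᵘ-/ i d = ℚ.toℚᵘ-fromℚᵘ (mkℚᵘ i d)

/-cross : ∀ i j d e .{{_ : NonZero d}} .{{_ : NonZero e}} → i ℤ.* + e ≡ j ℤ.* + d → i / d ≡ j / e
/-cross i j (suc d) (suc e) eq = ℚ.fromℚᵘ-cong {mkℚᵘ i d} {mkℚᵘ j e} (*≡* eq)

/-monoˡ-≤ : ∀ {i j} d .{{_ : NonZero d}} → i ℤ.≤ j → i / d ℚ.≤ j / d
/-monoˡ-≤ {i} {j} (suc d) i≤j = ℚ.toℚᵘ-cancel-≤ (begin
  toℚᵘ (i / suc d)  ≃⟨ toℚᵘ-/ i d ⟩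
  mkℚᵘ i d          ≤⟨ *≤* (ℤ.*-monoʳ-≤-nonNeg (+ suc d) i≤j) ⟩
  mkℚᵘ j d          ≃⟨ toℚᵘ-/ j d ⟨
  toℚᵘ (j / suc d)  ∎)
  where open ℚᵘ.≤-Reasoning

/-cancelˡ-≤ : ∀ {i j} d .{{_ : NonZero d}} → i / d ℚ.≤ j / d → i ℤ.≤ j
/-cancelˡ-≤ {i} {j} (suc d) i/d≤j/d = ℤ.*-cancelʳ-≤-pos i j (+ suc d) (ℚᵘ.drop-*≤* (begin
  mkℚᵘ i d          ≃⟨ toℚᵘ-/ i d ⟨
  toℚᵘ (i / suc d)  ≤⟨ ℚ.toℚᵘ-mono-≤ i/d≤j/d ⟩
  toℚᵘ (j / suc d)  ≃⟨ toℚᵘ-/ j d ⟩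
  mkℚᵘ j d          ∎))
  where open ℚᵘ.≤-Reasoning

/-*-/ : ∀ i j d e .{{_ : NonZero d}} .{{_ : NonZero e}} →
        (i / d) ℚ.* (j / e) ≡ ((i ℤ.* j) / (d * e)) {{ℕ.m*n≢0 d e}}
/-*-/ i j (suc d) (suc e) = ℚ.toℚᵘ-injective (begin
  toℚᵘ ((i / suc d) ℚ.* (j / suc e))        ≈⟨ ℚ.toℚᵘ-homo-* (i / suc d) (j / suc e) ⟩
  toℚᵘ (i / suc d) ℚᵘ.* toℚᵘ (j / suc e)    ≈⟨ ℚᵘ.*-cong (toℚᵘ-/ i d) (toℚᵘ-/ j e) ⟩
  mkℚᵘ i d ℚᵘ.* mkℚᵘ j e                    ≈⟨ toℚᵘ-/ (i ℤ.* j) _ ⟨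
  toℚᵘ ((i ℤ.* j) / (suc d * suc e))        ∎)
  where open ℚᵘ.≃-Reasoning

/-+-/ : ∀ i j d .{{_ : NonZero d}} → (i / d) ℚ.+ (j / d) ≡ (i ℤ.+ j) / d
/-+-/ i j (suc d) = ℚ.toℚᵘ-injective (begin
  toℚᵘ ((i / suc d) ℚ.+ (j / suc d))        ≈⟨ ℚ.toℚᵘ-homo-+ (i / suc d) (j / suc d) ⟩
  toℚᵘ (i / suc d) ℚᵘ.+ toℚᵘ (j / suc d)    ≈⟨ ℚᵘ.+-cong (toℚᵘ-/ i d) (toℚᵘ-/ j d) ⟩
  mkℚᵘ i d ℚᵘ.+ mkℚᵘ j d                    ≈⟨ *≡* (solve 3 (λ i j d →
      (i :* d :+ j :* d) :* d := (i :+ j) :* (d :* d)) refl i j (+ suc d)) ⟩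
  mkℚᵘ (i ℤ.+ j) d                          ≈⟨ toℚᵘ-/ (i ℤ.+ j) d ⟨
  toℚᵘ ((i ℤ.+ j) / suc d)                  ∎)
  where
  open ℚᵘ.≃-Reasoning
  open ℤ-Solver

sumℚ-/ : ∀ (f : Fin m → ℕ) d .{{_ : NonZero d}} → sumℚ {m} (λ i → + f i / d) ≡ + sum f / d
sumℚ-/ {zero}  f d = sym (ℚ.0/n≡0 d)
sumℚ-/ {suc m} f d = trans (cong (+ f zero / d ℚ.+_) (sumℚ-/ (f ∘ suc) d)) (/-+-/ (+ f zero) (+ sum (f ∘ suc)) d)

neg-/ : ∀ i d .{{_ : NonZero d}} → ℚ.- (i / d) ≡ ℤ.- i / d
neg-/ i (suc d) = ℚ.toℚᵘ-injective (begin
  toℚᵘ (ℚ.- (i / suc d))    ≈⟨ ℚ.toℚᵘ-homo‿- (i / suc d) ⟩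
  ℚᵘ.- toℚᵘ (i / suc d)     ≈⟨ ℚᵘ.-‿cong (toℚᵘ-/ i d) ⟩
  mkℚᵘ (ℤ.- i) d            ≈⟨ toℚᵘ-/ (ℤ.- i) d ⟨
  toℚᵘ (ℤ.- i / suc d)      ∎)
  where open ℚᵘ.≃-Reasoning

-- With `r` = p / d, division with remainder gives p < (⌊p / d⌋ + 1) d. Cancelling d leaves `i` <
-- ⌊r⌋ + 1, which for integers is the claim.
≤-floor : ∀ {i} r → i / 1 ℚ.≤ r → i ℤ.≤ ℚ.floor r
≤-floor {i} r@(mkℚ p d _) i≤r =
  subst (i ℤ.≤_) (ℤ.pred-suc (ℚ.floor r)) (ℤ.i<j⇒i≤pred[j] (ℤ.*-cancelʳ-<-nonNeg {i} {ℤ.suc (ℚ.floor r)} (+ suc d) (begin-strict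
    i ℤ.* + suc d                            ≤⟨ ℚᵘ.drop-*≤* (ℚᵘ.≤-respˡ-≃ (toℚᵘ-/ i 0) (ℚ.toℚᵘ-mono-≤ i≤r)) ⟩
    p ℤ.* + 1                                ≡⟨ ℤ.*-identityʳ p ⟩
    p                                        <⟨ ℤ.n<s[n/ℕd]*d p (suc d) ⟩
    ℤ.suc (p ℤ./ℕ suc d) ℤ.* + suc d         ≡⟨ cong (λ q → ℤ.suc q ℤ.* + suc d) (ℤ.div-pos-is-/ℕ p (suc d)) ⟨
    ℤ.suc (p ℤ./ + suc d) ℤ.* + suc d        ∎)))
  where open ℤ.≤-Reasoning

-- The ceiling is the negated floor of -r, so negation reduces this to `≤-floor`.
ceiling-≤ : ∀ {i} r → r ℚ.≤ i / 1 → ceiling r ℤ.≤ i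
ceiling-≤ {i} r@(mkℚ _ _ _) r≤i = subst (ceiling r ℤ.≤_) (ℤ.neg-involutive i)
  (ℤ.neg-mono-≤ (≤-floor (ℚ.- r) (subst (ℚ._≤ ℚ.- r) (neg-/ i 1) (ℚ.neg-antimono-≤ r≤i))))

/-≤ : ∀ {p l} q .{{_ : NonZero q}} → p ≤ⁿ l * q → + p / q ℚ.≤ + l / 1
/-≤ {p} {l} q p≤lq = subst (+ p / q ℚ.≤_)
  (/-cross (+ (l * q)) (+ l) q 1 (trans (ℤ.*-identityʳ _) (ℤ.pos-* l q)))
  (/-monoˡ-≤ q (+≤+ p≤lq))

-- From `c i * s i ≡ k` follows 1 / s i = c i / k, so all summands share the denominator `k`.
average-/ : ∀ {k} .{{_ : NonZero k}} .{{_ : NonZero m}} (s c w : Fin m → ℕ) (s≢0 : ∀ i → NonZero (s i)) →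
  (∀ i → c i * s i ≡ k) →
  (1ℤ / m) ℚ.* sumℚ {m} (λ i → (1ℤ / s i) {{s≢0 i}} ℚ.* (+ w i / 1)) ≡
  (+ sum (λ i → c i * w i) / (k * m)) {{ℕ.m*n≢0 k m}}
average-/ {m} {k} s c w s≢0 c*s≡k = begin
  (1ℤ / m) ℚ.* sumℚ {m} (λ i → (1ℤ / s i) {{s≢0 i}} ℚ.* (+ w i / 1))
    ≡⟨ cong ((1ℤ / m) ℚ.*_) (sumℚ-cong (λ i → term (s i) (c i) (w i) {{s≢0 i}} (c*s≡k i))) ⟩
  (1ℤ / m) ℚ.* sumℚ {m} (λ i → + (c i * w i) / k)
    ≡⟨ cong ((1ℤ / m) ℚ.*_) (sumℚ-/ (λ i → c i * w i) k) ⟩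
  (1ℤ / m) ℚ.* (+ sum (λ i → c i * w i) / k)
    ≡⟨ /-*-/ 1ℤ (+ sum (λ i → c i * w i)) m k ⟩
  (1ℤ ℤ.* + sum (λ i → c i * w i) / (m * k)) {{ℕ.m*n≢0 m k}}
    ≡⟨ ℚ./-cong {{ℕ.m*n≢0 m k}} {{ℕ.m*n≢0 k m}} (ℤ.*-identityˡ (+ sum (λ i → c i * w i))) (ℕ.*-comm m k) ⟩
  (+ sum (λ i → c i * w i) / (k * m)) {{ℕ.m*n≢0 k m}} ∎
  where
  open ≡-Reasoning
  sumℚ-cong : {f g : Fin m → ℚ} → f ≗ g → sumℚ f ≡ sumℚ g
  sumℚ-cong = sumℚ-cong-≗ {m}
  term : ∀ s c w .{{_ : NonZero s}} → c * s ≡ k → (1ℤ / s) ℚ.* (+ w / 1) ≡ + (c * w) / k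
  term s c w cs≡k = trans (/-*-/ 1ℤ (+ w) s 1)
    (/-cross (1ℤ ℤ.* + w) (+ (c * w)) (s * 1) k {{ℕ.m*n≢0 s 1}} (begin
      1ℤ ℤ.* + w ℤ.* + k         ≡⟨ cong (ℤ._* + k) (ℤ.*-identityˡ (+ w)) ⟩
      + w ℤ.* + k                ≡⟨ ℤ.pos-* w k ⟨
      + (w * k)                  ≡⟨ cong +_ (trans (cong (w *_) (sym cs≡k))
                                    (solve 3 (λ w c s → w :* (c :* s) := c :* w :* (s :* con 1)) refl w c s)) ⟩
      + (c * w * (s * 1))        ≡⟨ ℤ.pos-* (c * w) (s * 1) ⟩
      + (c * w) ℤ.* + (s * 1)    ∎))
    where open ℕ-Solver

-- Least ratios by exhaustive search

vectors : List X → ∀ n → List (Vec X n)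
vectors xs zero    = [] ∷ []
vectors xs (suc n) = cartesianProductWith _∷_ xs (vectors xs n)

∈-vectors : ∀ {xs : List X} → (∀ x → x ∈ˡ xs) → (v : Vec X n) → v ∈ˡ vectors xs n
∈-vectors ∈xs []      = here refl
∈-vectors ∈xs (x ∷ v) = ∈-cartesianProductWith⁺ _∷_ (∈xs x) (∈-vectors ∈xs v)

sift : {P : Pred X p} → Decidable P → List X → List (Σ X P)
sift P? []       = []
sift P? (x ∷ xs) with P? x
... | yes px = (x , px) ∷ sift P? xs
... | no _   = sift P? xs

-- The proof stored in the list is the one that `P?` produces and may differ from the given one,
-- hence the existential.
∈-sift : ∀ {P : Pred X p} (P? : Decidable P) {x xs} → x ∈ˡ xs → P x → ∃[ px ] (x , px) ∈ˡ sift P? xs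
∈-sift P? {xs = x ∷ xs} (here refl) px with P? x
... | yes px′ = px′ , here refl
... | no ¬px  = contradiction px ¬px
∈-sift P? {xs = x ∷ xs} (there x∈xs) px with P? x
... | yes _ = let px′ , ∈ = ∈-sift P? x∈xs px in px′ , there ∈
... | no _  = ∈-sift P? x∈xs px

-- `Q` may quantify over a large type, but its values are those of `f` on the finite type `X`.
-- Completeness asks for `y ≡ f x px` with every `px`, since the search meets whichever proof `P?`
-- returns.
least : ∀ {xs : List X} (∈xs : ∀ x → x ∈ˡ xs) {P : Pred X p} (P? : Decidable P)
        (f : ∀ x → P x → ℚ) {Q : Pred ℚ q} →
        (∀ x px → Q (f x px)) → (∀ y → Q y → ∃[ x ] P x × (∀ px → y ≡ f x px)) →
        Σ X P → ∃[ y ] IsLeast ℚ._≤_ Q y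
least {xs = xs} ∈xs P? f {Q} sound complete x₀ =
  -- The given valid candidate `x₀` is the starting value of `argmin`, so the list itself may be
  -- arbitrary.
  g (argmin g x₀ ys) , uncurry sound (argmin g x₀ ys) , λ y Qy →
    let x , px , y≡fx = complete y Qy
        px′ , ∈ys     = ∈-sift P? (∈xs x) px
    in subst (g (argmin g x₀ ys) ℚ.≤_) (sym (y≡fx px′)) (All.lookup (f[argmin]≤f[xs] {f = g} x₀ ys) ∈ys)
  where
  g  = uncurry f
  ys = sift P? xs

-- The recursion starts at 1 and not at 0 because λ is the smallest positive bound, even when every
-- count is zero.
supremum : ∀ (f : Fin n → ℕ) → ∃[ l ] IsLeast _≤ⁿ_ (λ l → 1 ≤ⁿ l × (∀ i → f i ≤ⁿ l)) l
supremum {zero}  f = 1 , (ℕ.≤-refl , λ ()) , λ _ → proj₁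
supremum {suc n} f with l , (1≤l , f≤l) , least-l ← supremum (f ∘ suc) =
  f zero ⊔ l ,
  (ℕ.≤-trans 1≤l (ℕ.m≤n⊔m (f zero) l) , λ where
    zero    → ℕ.m≤m⊔n (f zero) l
    (suc i) → ℕ.≤-trans (f≤l i) (ℕ.m≤n⊔m (f zero) l)) ,
  λ k (1≤k , f≤k) → ℕ.⊔-lub (f≤k zero) (least-l k (1≤k , f≤k ∘ suc))

IsLeast-⇔ : ∀ {P : Pred ℕ p} {Q : Pred ℕ q} → (∀ l → P l ⇔ Q l) → ∀ {l} → IsLeast _≤ⁿ_ P l → IsLeast _≤ⁿ_ Q l
IsLeast-⇔ P⇔Q (Pl , least-l) = Equivalence.to (P⇔Q _) Pl , λ k Qk → least-l k (Equivalence.from (P⇔Q k) Qk)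

IsLeast-unique : ∀ {P : Pred ℕ p} {k l} → IsLeast _≤ⁿ_ P k → IsLeast _≤ⁿ_ P l → k ≡ l
IsLeast-unique (Pk , least-k) (Pl , least-l) = ℕ.≤-antisym (least-k _ Pl) (least-l _ Pk)

lcms-cong : {k k′ : Fin m → ℕ} → k ≗ k′ → lcms k ≡ lcms k′
lcms-cong {zero}  k≗k′ = refl
lcms-cong {suc m} k≗k′ = cong₂ lcm (k≗k′ zero) (lcms-cong (k≗k′ ∘ suc))

∣-lcms : ∀ (k : Fin m → ℕ) i → k i ∣ lcms k
∣-lcms k zero    = m∣lcm[m,n] (k zero) (lcms (k ∘ suc))
∣-lcms k (suc i) = ∣-trans (∣-lcms (k ∘ suc) i) (n∣lcm[m,n] (k zero) (lcms (k ∘ suc)))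

-- Weights, and decidability of the defining conditions

module _ (K : Composition m a) where
  open Composition K

  weights : Fin m → ℕ
  weights i = k̃ K ℕ./ part i

  weights*part : ∀ i → weights i * part i ≡ k̃ K
  weights*part i = m/n*n≡m (∣-lcms part i)

  k̃≢0 : NonZero (k̃ K)
  k̃≢0 = lcms≢0 part positive

open Composition using (part; positive; total)

weights-cong : ∀ (K K′ : Composition m a) → part K ≗ part K′ → weights K ≗ weights K′
weights-cong K K′ K≗K′ i = trans
  (/-congʳ {{positive K i}} {{positive K′ i}} (K≗K′ i))
  (/-congˡ {{positive K′ i}} (lcms-cong K≗K′))

composition : ∀ {B : Fin m → Subset n} → IsDisjointFamily B → sum (λ i → ∣ B i ∣) ≡ a → Composition m a
composition {B = B} isFamily total = record
  { part     = λ i → ∣ B i ∣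
  ; positive = λ i → nonempty⇒∣p∣≢0 (nonempty i)
  ; total    = total
  }
  where open IsDisjointFamily isFamily

isDisjointFamily? : Decidable (IsDisjointFamily {n = n} {I = Fin m})
isDisjointFamily? B = map′
  (λ (ne , dj) → record { nonempty = ne ; disjoint = λ {i} {j} → dj i j })
  (λ fam → let open IsDisjointFamily fam in nonempty , λ i j → disjoint)
  (Fin.all? (λ i → nonempty? (B i)) ×-dec
   Fin.all? (λ i → Fin.all? (λ j → ¬? (i Fin.≟ j) →-dec ¬? (nonempty? (B i ∩ B j)))))

IsDisjointFamily-resp : ∀ {B B′ : Fin m → Subset n} → B ≗ B′ → IsDisjointFamily B → IsDisjointFamily B′
IsDisjointFamily-resp B≗B′ fam = record
  { nonempty = λ i → subst Nonempty (B≗B′ i) (nonempty i)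
  ; disjoint = λ {i} {j} i≢j → subst₂ (λ p q → Empty (p ∩ q)) (B≗B′ i) (B≗B′ j) (disjoint i≢j)
  }
  where open IsDisjointFamily fam

-- On `Fin n` with propositional equality the laws are finitely many equations; commutativity
-- supplies the right-hand versions of identity and inverse.
isAbelianGroup? : ∀ (_∙_ : Fin n → Fin n → Fin n) ε _⁻¹ → Dec (IsAbelianGroup _≡_ _∙_ ε _⁻¹)
isAbelianGroup? {n} _∙_ ε _⁻¹ = map′
  (λ (assoc , comm , idˡ , invˡ) → record
    { isGroup = record
      { isMonoid = record
        { isSemigroup = record
          { isMagma = record { isEquivalence = isEquivalence ; ∙-cong = cong₂ _∙_ }
          ; assoc   = assoc
          }
        ; identity = comm∧idˡ⇒id comm idˡ
        }
      ; inverse = comm∧invˡ⇒inv comm invˡ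
      ; ⁻¹-cong = cong _⁻¹
      }
    ; comm = comm
    })
  (λ isAG → let open IsAbelianGroup isAG in assoc , comm , identityˡ , inverseˡ)
  (Fin.all? (λ x → Fin.all? (λ y → Fin.all? (λ z → ((x ∙ y) ∙ z) Fin.≟ (x ∙ (y ∙ z))))) ×-dec
   Fin.all? (λ x → Fin.all? (λ y → (x ∙ y) Fin.≟ (y ∙ x))) ×-dec
   Fin.all? (λ x → (ε ∙ x) Fin.≟ x) ×-dec
   Fin.all? (λ x → ((x ⁻¹) ∙ x) Fin.≟ ε))

-- Candidates for a BSWEDF up to isomorphism: addition table, zero and negation
-- of a group on Fin n, and m subsets.
Table : ℕ → ℕ → Set
Table n m = Vec (Vec (Fin n) n) n × Fin n × Vec (Fin n) n × Vec (Subset n) m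

tables : ∀ n m → List (Table n m)
tables n m = cartesianProduct (vectors (vectors (allFin n) n) n)
  (cartesianProduct (allFin n) (cartesianProduct (vectors (allFin n) n)
    (vectors (vectors (true ∷ false ∷ []) n) m)))

∈-tables : ∀ (t : Table n m) → t ∈ˡ tables n m
∈-tables (sums , z , negs , B) =
  ∈-cartesianProduct⁺ (∈-vectors (∈-vectors ∈-allFin) sums)
    (∈-cartesianProduct⁺ (∈-allFin z) (∈-cartesianProduct⁺ (∈-vectors ∈-allFin negs)
      (∈-vectors (∈-vectors λ where
        true  → here refl
        false → there (here refl)) B)))

add : Vec (Vec (Fin n) n) n → Fin n → Fin n → Fin n
add sums x y = lookup (lookup sums x) y

-- The tuple of sizes is not part of a table, because the subsets determine it.
Valid : ∀ (a : ℕ) → Table n m → Set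
Valid a (sums , z , negs , B) =
  IsAbelianGroup _≡_ (add sums) z (lookup negs) ×
  IsDisjointFamily (lookup B) ×
  sum (λ i → ∣ lookup B i ∣) ≡ a

valid? : ∀ a → Decidable (Valid {n} {m} a)
valid? a (sums , z , negs , B) =
  isAbelianGroup? (add sums) z (lookup negs) ×-dec
  isDisjointFamily? (lookup B) ×-dec
  sum (λ i → ∣ lookup B i ∣) ℕ.≟ a

tabulated : FiniteAbelianGroup n c ℓ → (Fin m → Subset n) → Table n m
tabulated G B =
  tabulate (λ x → tabulate (op G x)) , index 0# , tabulate (λ x → index (- element x)) , tabulate B
  where open FiniteAbelianGroup G

add-tabulated : ∀ (f : Fin n → Fin n → Fin n) x y → add (tabulate (λ x → tabulate (f x))) x y ≡ f x y
add-tabulated f x y = trans (cong (λ v → lookup v y) (lookup∘tabulate _ x)) (lookup∘tabulate (f x) y)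

-- The map `element` is an injective homomorphism from the table into `G`, so the group laws pull
-- back along it, and the levels of `G` disappear.
valid-tabulated : ∀ (G : FiniteAbelianGroup n c ℓ) {B : Fin m → Subset n} → IsDisjointFamily B →
                  sum (λ i → ∣ B i ∣) ≡ a → Valid a (tabulated G B)
valid-tabulated {n} {m = m} G {B} isFamily total =
  GroupMonomorphism.isAbelianGroup {G₁ = rawG} {G₂ = rawGroup} {⟦_⟧ = element} isGroupMonomorphism isAbelianGroup ,
  IsDisjointFamily-resp (λ i → sym (lookup∘tabulate B i)) isFamily ,
  trans (sum-cong-≗ {m} (λ i → cong ∣_∣ (lookup∘tabulate B i))) total
  where
  open FiniteAbelianGroup G
  open AbelianGroup abelianGroup using (isAbelianGroup; rawGroup)
  module ≈ = Setoid ≈-setoid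
  open Inverse enumeration using (strictlyInverseˡ; strictlyInverseʳ)
    renaming (to-cong to index-cong; from-cong to element-cong)
  rawG : RawGroup 0ℓ 0ℓ
  rawG = record
    { Carrier = Fin n ; _≈_ = _≡_
    ; _∙_ = add (proj₁ (tabulated G B)) ; ε = index 0#
    ; _⁻¹ = lookup (proj₁ (proj₂ (proj₂ (tabulated G B))))
    }
  open GroupMorphisms rawG rawGroup using (IsGroupMonomorphism)
  isGroupMonomorphism : IsGroupMonomorphism element
  isGroupMonomorphism = record
    { isGroupHomomorphism = record
      { isMonoidHomomorphism = record
        { isMagmaHomomorphism = record
          { isRelHomomorphism = record { cong = element-cong }
          ; homo = λ x y → ≈.trans (element-cong (add-tabulated (op G) x y)) (strictlyInverseʳ _)
          }
        ; ε-homo = strictlyInverseʳ 0#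
        }
      ; ⁻¹-homo = λ x → ≈.trans (element-cong (lookup∘tabulate _ x)) (strictlyInverseʳ _)
      }
    ; injective = λ {x} {y} x≈y → trans (sym (strictlyInverseˡ x)) (trans (index-cong x≈y) (strictlyInverseˡ y))
    }

module FromTable (t : Table n m) (valid : Valid a t) where
  blocks : Fin m → Subset n
  blocks = lookup (proj₂ (proj₂ (proj₂ t)))

  isFamily : IsDisjointFamily blocks
  isFamily = proj₁ (proj₂ valid)

  group : FiniteAbelianGroup n 0ℓ 0ℓ
  group = record
    { abelianGroup = record { isAbelianGroup = proj₁ valid }
    ; enumeration  = record { to = id ; from = id ; to-cong = id ; from-cong = id ; inverse = id , id }
    }

  K : Composition m a
  K = composition isFamily (proj₂ (proj₂ valid))

  -- The enumeration of `group` is the identity, so its `op` reduces to `add` of the table, and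
  -- `⊑⊠⇔` applies to this count without conversion.
  hitCount : Fin n → ℕ
  hitCount = weightedHits (weights K) (add (proj₁ t)) blocks

  Bounds : Pred ℕ 0ℓ
  Bounds l = 1 ≤ⁿ l × (∀ δ → hitCount δ ≤ⁿ l)

  λ′ : ℕ
  λ′ = proj₁ (supremum hitCount)

  λ′-least : IsLeast _≤ⁿ_ Bounds λ′
  λ′-least = proj₂ (supremum hitCount)

  bswedf : BSWEDF 0ℓ 0ℓ n m a K λ′
  bswedf = record
    { G         = group
    ; B         = blocks
    ; isFamily  = isFamily
    ; sizes     = λ _ → refl
    ; isMinimum = IsLeast-⇔ (λ l → mk⇔
        (λ (1≤l , ≤l) → 1≤l , Equivalence.from (⊑⊠⇔ group (weights K) isFamily l) ≤l)
        (λ (1≤l , ⊑l) → 1≤l , Equivalence.to (⊑⊠⇔ group (weights K) isFamily l) ⊑l)) λ′-least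
    }

  ratio : .{{_ : NonZero m}} → ℚ
  ratio = (+ λ′ / (k̃ K * m)) {{k̃*m≢0 K}}

-- Invariance under passage to the table

module _ {K : Composition m a} (G : FiniteAbelianGroup n c ℓ) {B : Fin m → Subset n}
         (sizes : ∀ i → ∣ B i ∣ ≡ part K i) (valid : Valid a (tabulated G B)) where
  private module T = FromTable (tabulated G B) valid

  part-tabulated : part T.K ≗ part K
  part-tabulated i = trans (cong ∣_∣ (lookup∘tabulate B i)) (sizes i)

  k̃-tabulated : k̃ T.K ≡ k̃ K
  k̃-tabulated = lcms-cong part-tabulated

  hitCount-tabulated : ∀ δ → T.hitCount δ ≡ weightedHits (weights K) (op G) B δ
  hitCount-tabulated = weightedHits-cong
    (weights-cong T.K K part-tabulated) (add-tabulated (op G)) (lookup∘tabulate B)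

module _ {K : Composition m a} {l} (X : BSWEDF c ℓ n m a K l) where
  open BSWEDF X

  Σ∣B∣ : sum (λ i → ∣ B i ∣) ≡ a
  Σ∣B∣ = trans (sum-cong-≗ {m} sizes) (total K)

  bswedf⇒valid : Valid a (tabulated G B)
  bswedf⇒valid = valid-tabulated G isFamily Σ∣B∣

  -- Equal hit counts make the two conditions on λ equivalent, and least elements are unique. The
  -- statement holds for every `valid`, as `least` demands.
  bswedf-ratio : .{{_ : NonZero m}} → ∀ valid →
                 (+ l / (k̃ K * m)) {{k̃*m≢0 K}} ≡ FromTable.ratio (tabulated G B) valid
  bswedf-ratio valid = ℚ./-cong {{k̃*m≢0 K}} {{k̃*m≢0 T.K}}
    (cong +_ (IsLeast-unique (IsLeast-⇔ (λ k → mk⇔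
      (λ (1≤k , ⊑k) → 1≤k , λ δ → subst (_≤ⁿ k) (sym (hits≡ δ)) (Equivalence.to (⊑k⇔ k) ⊑k δ))
      (λ (1≤k , ≤k) → 1≤k , Equivalence.from (⊑k⇔ k) (λ δ → subst (_≤ⁿ k) (hits≡ δ) (≤k δ)))) isMinimum) T.λ′-least))
    (cong (_* m) (sym (k̃-tabulated {K = K} G sizes valid)))
    where
    module T = FromTable (tabulated G B) valid
    hits≡ = hitCount-tabulated {K = K} G sizes valid
    ⊑k⇔ = ⊑⊠⇔ G (weights K) isFamily

  bswedf-bound : k̃ K * a * (m ∸ 1) ≤ⁿ l * (n ∸ 1)
  bswedf-bound = subst (λ a → k̃ K * a * (m ∸ 1) ≤ⁿ l * (n ∸ 1)) Σ∣B∣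
    (counting-bound G (weights K) B
      (λ j → trans (cong (weights K j *_) (sizes j)) (weights*part K j))
      (proj₂ (proj₁ isMinimum)))

-- Existence of the two minima, and their comparison

module _ (m a : ℕ) where
  -- No part exceeds the total `a`, so `Fin (suc a)` has room for every part and the compositions
  -- form a finite search space.
  PartsTable : Set
  PartsTable = Vec (Fin (suc a)) m

  IsComposition : Pred PartsTable 0ℓ
  IsComposition v = (∀ i → NonZero (toℕ (lookup v i))) × sum (λ i → toℕ (lookup v i)) ≡ a

  isComposition? : Decidable IsComposition
  isComposition? v = Fin.all? (λ i → ℕ.nonZero? (toℕ (lookup v i))) ×-dec
                     sum (λ i → toℕ (lookup v i)) ℕ.≟ a

  fromParts : ∀ v → IsComposition v → Composition m a
  fromParts v (positive , total) = record { part = λ i → toℕ (lookup v i) ; positive = positive ; total = total }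

  module _ (K : Composition m a) where
    part<1+a : ∀ i → suc (part K i) ≤ⁿ suc a
    part<1+a i = s≤s (subst (part K i ≤ⁿ_) (total K) (≤-sum (part K) i))

    toParts : PartsTable
    toParts = tabulate (λ i → fromℕ< (part<1+a i))

    lookup-toParts : ∀ i → toℕ (lookup toParts i) ≡ part K i
    lookup-toParts i = trans (cong toℕ (lookup∘tabulate _ i)) (Fin.toℕ-fromℕ< (part<1+a i))

    isComposition-toParts : IsComposition toParts
    isComposition-toParts =
      (λ i → subst NonZero (sym (lookup-toParts i)) (positive K i)) ,
      trans (sum-cong-≗ {m} lookup-toParts) (total K)

  module _ {n : ℕ} .{{_ : NonZero m}} .{{_ : NonZero (n ∸ 1)}} where
    boundRatio : Composition m a → ℚ
    boundRatio K = (ceiling (+ (k̃ K * a * (m ∸ 1)) / (n ∸ 1)) / (k̃ K * m)) {{k̃*m≢0 K}}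

    boundRatio-cong : ∀ K K′ → part K ≗ part K′ → boundRatio K ≡ boundRatio K′
    boundRatio-cong K K′ K≗K′ = ℚ./-cong {{k̃*m≢0 K}} {{k̃*m≢0 K′}}
      (cong (λ k → ceiling (+ (k * a * (m ∸ 1)) / (n ∸ 1))) (lcms-cong K≗K′))
      (cong (_* m) (lcms-cong K≗K′))

    leastBoundRatio : Composition m a → ∃[ y ] IsMinBoundRatio n m a y
    leastBoundRatio K₀ = least (∈-vectors ∈-allFin) isComposition?
      (λ v valid → boundRatio (fromParts v valid))
      (λ v valid → fromParts v valid , refl)
      (λ y (K , y≡) → toParts K , isComposition-toParts K , λ valid →
        trans y≡ (boundRatio-cong K (fromParts (toParts K) valid) (λ i → sym (lookup-toParts K i))))
      (toParts K₀ , isComposition-toParts K₀)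

leastBSWEDFRatio : .{{_ : NonZero m}} → Σ (Table n m) (Valid a) → ∃[ y ] IsMinBSWEDFRatio n m a y
leastBSWEDFRatio {m} {n} {a} t₀ = least ∈-tables (valid? a)
  (λ t valid → FromTable.ratio t valid)
  (λ t valid → let open FromTable t valid in K , λ′ , bswedf , refl)
  (λ y (K , l , X , y≡) → let open BSWEDF X in
    tabulated G B , bswedf⇒valid X , λ valid → trans y≡ (bswedf-ratio X valid))
  t₀

-- Both sides have the denominator k̃ m of the same `K`, so only numerators are compared; λ is an
-- integer above the quotient and hence above its ceiling.
boundRatio-≤ : ∀ {n} .{{_ : NonZero m}} .{{_ : NonZero (n ∸ 1)}} {K : Composition m a} {l} →
               BSWEDF c ℓ n m a K l → boundRatio m a {n} K ℚ.≤ (+ l / (k̃ K * m)) {{k̃*m≢0 K}}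
boundRatio-≤ {m} {a} {n = n} {K = K} {l} X = /-monoˡ-≤ (k̃ K * m) {{k̃*m≢0 K}}
  (ceiling-≤ {+ l} (+ (k̃ K * a * (m ∸ 1)) / (n ∸ 1)) (/-≤ {k̃ K * a * (m ∸ 1)} {l} (n ∸ 1) (bswedf-bound X)))

-- From a code to a BSWEDF

module _ {s c ℓ : Level} {n m a : ℕ} .{{_ : NonZero m}} .{{_ : NonZero (n ∸ 1)}} {ρ : ℚ}
         (code : WeakAMDCode s c ℓ n m a ρ) where
  open WeakAMDCode code hiding (others)
  open FiniteAbelianGroup G hiding (_+_)
  private module G = FiniteAbelianGroup G
  open Inverse enumeration using (strictlyInverseˡ) renaming (to-cong to index-cong)
  open Inverse sources using () renaming (to to source)

  encodings : Fin m → Subset n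
  encodings i = A (source i)

  encodings-isFamily : IsDisjointFamily encodings
  encodings-isFamily = record
    { nonempty = λ i → nonempty (source i)
    ; disjoint = λ i≢j → disjoint (λ si≡sj → i≢j (Injection.injective (Inverse⇒Injection sources) si≡sj))
    }
    where open IsDisjointFamily isFamily

  codeComposition : Composition m a
  codeComposition = composition encodings-isFamily totalSize

  codeTable : Table n m
  codeTable = tabulated G encodings

  codeTable-valid : Valid a codeTable
  codeTable-valid = valid-tabulated G encodings-isFamily totalSize

  private
    K = codeComposition
    module T = FromTable codeTable codeTable-valid

  codeHits : Fin n → ℕ
  codeHits = weightedHits (weights K) (op G) encodings

  winning≡hits : ∀ Δ i → winning Δ i ≡ hits (op G) encodings i (index Δ)
  winning≡hits Δ i = begin
    winning Δ i
      ≡⟨ length-filter≡sumOver (λ g → index (g G.+ Δ) ∈? others encodings i) (elements (encodings i)) ⟩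
    sumOver (λ g → 𝟙 (index (g G.+ Δ) ∈? others encodings i)) (elements (encodings i))
      ≡⟨ sumOver-elements G (λ g → 𝟙 (index (g G.+ Δ) ∈? others encodings i)) (encodings i) ⟩
    sum (λ y → 𝟙 (y ∈? encodings i) * 𝟙 (index (element y G.+ Δ) ∈? others encodings i))
      ≡⟨ sum-cong-≗ {n} (λ y → cong (λ z → 𝟙 (y ∈? encodings i) * 𝟙 (z ∈? others encodings i))
           (op-index G y Δ)) ⟨
    hits (op G) encodings i (index Δ) ∎
    where open ≡-Reasoning

  ρ[]≡ratio : ∀ Δ → ρ[ Δ ] ≡ (+ codeHits (index Δ) / (k̃ K * m)) {{k̃*m≢0 K}}
  ρ[]≡ratio Δ = trans
    (average-/ {k = k̃ K} {{k̃≢0 K}} (part K) (weights K) (winning Δ) (positive K) (weights*part K))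
    (ℚ./-cong {{k̃*m≢0 K}} {{k̃*m≢0 K}} (cong +_ (sum-cong-≗ {m} (λ i →
      cong (weights K i *_) (winning≡hits Δ i)))) refl)

  -- The hit count `M` of an optimal Δ is positive and bounds all hit counts, so it is admissible in
  -- the definition of λ, and minimality gives λ ≤ `M`.
  ratio≤ρ : 2 ≤ⁿ m → T.ratio ℚ.≤ ρ
  ratio≤ρ 2≤m = ℚ.≤-trans ratio≤M/k̃m (ℚ.≤-reflexive (trans M/k̃m≡ (sym ρ≡M/k̃m)))
    where
    Δ = proj₁ (proj₁ isMaximum)

    M : ℕ
    M = codeHits (index Δ)

    ρ≡M/k̃m : ρ ≡ (+ M / (k̃ K * m)) {{k̃*m≢0 K}}
    ρ≡M/k̃m = trans (proj₂ (proj₂ (proj₁ isMaximum))) (ρ[]≡ratio Δ)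

    M/k̃m≡ : (+ M / (k̃ T.K * m)) {{k̃*m≢0 T.K}} ≡ (+ M / (k̃ K * m)) {{k̃*m≢0 K}}
    M/k̃m≡ = ℚ./-cong {+ M} {k̃ T.K * m} {+ M} {k̃ K * m} {{k̃*m≢0 T.K}} {{k̃*m≢0 K}} refl
      (cong (_* m) (k̃-tabulated {K = K} G (λ _ → refl) codeTable-valid))

    -- Zero is not a choice of the adversary, so there the vanishing of the hits replaces the
    -- maximality of ρ. Elsewhere the common denominator is cancelled.
    ≤M : ∀ δ → codeHits δ ≤ⁿ M
    ≤M δ with element δ ≈? 0#
    ... | yes δ≈0 = subst (_≤ⁿ M) (sym (trans
      (cong codeHits (trans (sym (strictlyInverseˡ δ)) (index-cong δ≈0)))
      (weightedHits-0# G (weights K) encodings-isFamily))) z≤n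
    ... | no δ≉0  = subst (λ δ → codeHits δ ≤ⁿ M) (strictlyInverseˡ δ)
      (ℤ.drop‿+≤+ (/-cancelˡ-≤ (k̃ K * m) {{k̃*m≢0 K}} (subst₂ ℚ._≤_
        (ρ[]≡ratio (element δ)) ρ≡M/k̃m
        (proj₂ isMaximum ρ[ element δ ] (element δ , δ≉0 , refl)))))

    k̃*Σ*[m-1]≢0 : k̃ K * sum (part K) * (m ∸ 1) ≢ 0
    k̃*Σ*[m-1]≢0 eq with ℕ.m*n≡0⇒m≡0∨n≡0 (k̃ K * sum (part K)) eq
    ... | inj₂ m-1≡0 = contradiction m-1≡0 (ℕ.m>n⇒m∸n≢0 2≤m)
    ... | inj₁ kΣ≡0 with ℕ.m*n≡0⇒m≡0∨n≡0 (k̃ K) kΣ≡0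
    ...   | inj₁ k≡0 = ≢-nonZero⁻¹ (k̃ K) {{k̃≢0 K}} k≡0
    ...   | inj₂ Σ≡0 = ≢-nonZero⁻¹ (part K i₀) {{positive K i₀}}
      (ℕ.n≤0⇒n≡0 (subst (part K i₀ ≤ⁿ_) Σ≡0 (≤-sum (part K) i₀)))
      -- Any block would do; the index only witnesses that a positive part exists.
      where i₀ = fromℕ< (ℕ.<-trans (s≤s z≤n) 2≤m)

    -- For m ≥ 2 there are external differences at all, so the maximum is not 0.
    1≤M : 1 ≤ⁿ M
    1≤M = ℕ.n≢0⇒n>0 λ M≡0 → k̃*Σ*[m-1]≢0 (ℕ.n≤0⇒n≡0
      (subst (λ l → k̃ K * sum (part K) * (m ∸ 1) ≤ⁿ l * (n ∸ 1)) M≡0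
        (counting-bound G {l = M} (weights K) encodings (weights*part K)
          (Equivalence.from (⊑⊠⇔ G (weights K) encodings-isFamily M) ≤M))))

    ratio≤M/k̃m : T.ratio ℚ.≤ (+ M / (k̃ T.K * m)) {{k̃*m≢0 T.K}}
    ratio≤M/k̃m = /-monoˡ-≤ {+ T.λ′} {+ M} (k̃ T.K * m) {{k̃*m≢0 T.K}} (+≤+ (proj₂ T.λ′-least M
      (1≤M , λ δ → subst (_≤ⁿ M) (sym (hitCount-tabulated {K = K} G (λ _ → refl) codeTable-valid δ)) (≤M δ))))

corollary1 : ∀ {s c ℓ : Level} (n m a : ℕ) .{{_ : NonZero m}} .{{_ : NonZero (n ∸ 1)}} (ρ : ℚ) →
    WeakAMDCode s c ℓ n m a ρ →
    ∃[ ρₙₘₐ ] ∃[ bound ]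
    IsMinBSWEDFRatio n m a ρₙₘₐ ×
    IsMinBoundRatio n m a bound ×
    (2 ≤ⁿ m → ρ ≥ ρₙₘₐ) ×
    ρₙₘₐ ≥ bound
corollary1 n m a ρ code =
  -- The code itself shows that both sets of ratios are inhabited, so that the minima exist.
  let (ρₙₘₐ , minBSWEDF) = leastBSWEDFRatio (codeTable code , codeTable-valid code)
      (bound , minBound) = leastBoundRatio m a {n} (codeComposition code)
      ((K , l , X , ρₙₘₐ≡) , ρₙₘₐ-least) = minBSWEDF
  in ρₙₘₐ , bound , minBSWEDF , minBound ,
     (λ 2≤m → ℚ.≤-trans (ρₙₘₐ-least T.ratio (T.K , T.λ′ , T.bswedf , refl)) (ratio≤ρ code 2≤m)) ,
     -- `K` comes from a BSWEDF that attains the minimum; its own bound lies between `bound` and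
     -- ρₙₘₐ.
     ℚ.≤-trans (proj₂ minBound (boundRatio m a {n} K) (K , refl))
       (subst (boundRatio m a {n} K ℚ.≤_) (sym ρₙₘₐ≡) (boundRatio-≤ X))
  where module T = FromTable (codeTable code) (codeTable-valid code)
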